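{- Let $n$, $k$, $t$ and $s$ be positive integers with $k\geq t+2$ and $n\geq 3\max\left\{\binom{t+2}{2}, \frac{k-t}{2} \right\}\left((k-t+1)^{2}+s\right)$. Suppose $\mathcal{F}\subseteq \binom{[n]}{k}$ is an $s$-almost $t$-intersecting family which is not $t$-intersecting, and that $\mathcal{F}$ has the maximum size among all $s$-almost $t$-intersecting subfamilies of $\binom{[n]}{k}$ that are not $t$-intersecting. Then $$\mathcal{F}\cong\left\{F\in\binom{[n]}{k}: [t]\subseteq F,\ \left|F\cap [k+1]\right|\geq t+1\right\}\cup \mathcal{A}\cup \mathcal{B},$$ where $\mathcal{A}$ is an $s$-subset of $\left\{ F\in\binom{[n]}{k}: F\cap [k+1]=[t]\right\}$ and $\mathcal{B}$ is a $\min\{t,s\}$-subset of $\left\{F\in\binom{[k+1]}{k}: [t]\not\subseteq F\right\}$.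
   Context: $[n]=\{1,\dots,n\}$ and $\binom{X}{k}$ denotes the family of all $k$-subsets of a set $X$. A family $\mathcal{F}\subseteq\binom{[n]}{k}$ is called $s$-almost $t$-intersecting if $\left|\{F'\in\mathcal{F}: |F'\cap F|<t\}\right|\leq s$ for every $F\in\mathcal{F}$; it is $t$-intersecting if $|F\cap F'|\geq t$ for all $F,F'\in\mathcal{F}$. $\mathcal{F}\cong\mathcal{G}$ means there is a permutation of $[n]$ mapping $\mathcal{F}$ onto $\mathcal{G}$. An $m$-subset of a family is a subfamily with exactly $m$ members. -}

module Defs where

open import Data.Bool using (Bool; true; false; _∧_; _∨_; if_then_else_; T)
open import Data.Nat using (ℕ; zero; suc; _+_; _<ᵇ_; _≤ᵇ_; _≡ᵇ_; _≤_)
open import Data.List using (List; []; _∷_; map; _++_)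
open import Data.Fin using (Fin; toℕ)
open import Data.Vec using (tabulate; lookup; _∷_; [])
open import Data.Fin.Subset using (Subset; _∩_; ∣_∣; _⊆_)
open import Data.Fin.Subset.Properties using (_⊆?_)
open import Data.Fin.Permutation using (Permutation′; _⟨$⟩ˡ_)
open import Data.Product using (∃; _×_)
open import Relation.Nullary using (¬_)
open import Relation.Nullary.Decidable using (⌊_⌋)
open import Relation.Binary.PropositionalEquality using (_≡_)

Family : ℕ → Set
Family n = Subset n → Bool

allSubsets : (n : ℕ) → List (Subset n)
allSubsets zero = [] ∷ []
allSubsets (suc n) = map (true ∷_) (allSubsets n) ++ map (false ∷_) (allSubsets n)

countL : ∀ {n} → (Subset n → Bool) → List (Subset n) → ℕ
countL p [] = 0
countL p (x ∷ xs) = if p x then suc (countL p xs) else countL p xs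

count : ∀ {n} → (Subset n → Bool) → ℕ
count {n} p = countL p (allSubsets n)

size : ∀ {n} → Family n → ℕ
size = count

Uniform : ∀ {n} → ℕ → Family n → Set
Uniform k 𝓕 = ∀ F → T (𝓕 F) → ∣ F ∣ ≡ k

AlmostIntersecting : ∀ {n} → ℕ → ℕ → Family n → Set
AlmostIntersecting s t 𝓕 =
  ∀ F → T (𝓕 F) → count (λ F′ → 𝓕 F′ ∧ (∣ F′ ∩ F ∣ <ᵇ t)) ≤ s

Intersecting : ∀ {n} → ℕ → Family n → Set
Intersecting t 𝓕 = ∀ F F′ → T (𝓕 F) → T (𝓕 F′) → t ≤ ∣ F ∩ F′ ∣

-- [m] = {1,…,m} as a subset of [n] (elements of Fin n are 0-based: i ↦ i+1)
[_]ₛ : ∀ {n} → ℕ → Subset n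
[ m ]ₛ = tabulate (λ i → toℕ i <ᵇ m)

image : ∀ {n} → Permutation′ n → Subset n → Subset n
image σ F = tabulate (λ i → lookup F (σ ⟨$⟩ˡ i))

_≅_ : ∀ {n} → Family n → Family n → Set
_≅_ {n} 𝓕 𝓖 = ∃ λ (σ : Permutation′ n) → ∀ F → 𝓕 F ≡ 𝓖 (image σ F)

_∪ᶠ_ : ∀ {n} → Family n → Family n → Family n
(𝓕 ∪ᶠ 𝓖) F = 𝓕 F ∨ 𝓖 F

HFam : ∀ {n} → ℕ → ℕ → Family n
HFam k t F = (∣ F ∣ ≡ᵇ k) ∧ ⌊ [ t ]ₛ ⊆? F ⌋ ∧ (suc t ≤ᵇ ∣ F ∩ [ suc k ]ₛ ∣)

{-# OPTIONS --safe #-}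

-- Write d = k − t, let N₁ and N₂ be the numbers of k-sets through t + 1 and through
-- t + 2 given points, and let ℓ = s + (d + 1) N₂.  If a member G meets a set S in fewer
-- than t points, then any d + 1 points of G outside S meet all members that meet G in at
-- least t points, so at most s + (d + 1) max deg (S ∪ x) members contain S.  Hence a
-- (t + 1)-set of degree exceeding ℓ ("heavy") meets every member in at least t points,
-- and two heavy sets meet in at least t points.
--
-- Two distinct heavy sets meet in a t-set R; all heavy sets contain R, since otherwise a
-- (t + 2)-set meets all members in t + 1 points and the family is t-intersecting.  Pick a
-- member G not containing R.  Either some R ∪ x with x ∈ G ∖ R is light, and then only
-- about d N₁ members exist, or all members not containing R lie in W = R ∪ G, of size k + 1,
-- which forces the extremal pattern.
--
-- If there is at most one heavy set, take a smallest set S that meets all but s members in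
-- at least t points.  Counting the members through the t-subsets of S and branching bounds
-- the family by roughly (1 + (d + 2) / 4) N₁ when |S| = t + 1, and by (3 (d + 2) / 8) N₁ when
-- |S| > t + 1, whereas the extremal pattern has more than (d + 1 / 2) N₁ members.
module Submission where

open import Defs
open import Data.Bool using (Bool; true; false; T; _∧_; _∨_; if_then_else_)
open import Data.Bool.Properties using (T?)
import Data.Bool.Properties as Bool
open import Data.Empty using (⊥-elim)
open import Data.Fin using (Fin; zero; suc; toℕ; fromℕ<; punchIn; punchOut)
open import Data.Fin.Permutation using (Permutation′; _⟨$⟩ˡ_; _⟨$⟩ʳ_; insert; inverseˡ; inverseʳ; flip)
import Data.Fin.Permutation as Perm
open import Data.Fin.Properties using (any?; punchIn-punchOut; toℕ-fromℕ<)
import Data.Fin.Properties as Fin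
open import Data.Fin.Subset using (Subset; _∩_; _∪_; ∁; ∣_∣; _∈_; _∉_; _⊆_; _⊈_; ⁅_⁆; ⊤; ⊥; Nonempty)
open import Data.Fin.Subset.Properties
open import Data.List using (List; []; _∷_; map; _++_)
open import Data.Nat
open import Data.Nat.Combinatorics using (_C_; nC1≡n; nCk≡nC[n∸k]; nCk+nC[k+1]≡[n+1]C[k+1])
open import Data.Nat.Properties
open import Data.Nat.Tactic.RingSolver using (solve; solve-∀)
open import Data.Product using (Σ; ∃; _×_; _,_; proj₁; proj₂)
open import Data.Sum using (_⊎_; inj₁; inj₂; [_,_]′)
open import Data.Vec.Properties
  using (≡-dec; ∷-injectiveˡ; ∷-injectiveʳ; tabulate-cong; lookup∘tabulate; tabulate∘lookup; lookup-zipWith)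
open import Function using (_∘_; id)
open import Relation.Nullary using (¬_; Dec; yes; no)
open import Relation.Nullary.Decidable using (_×-dec_; _⊎-dec_; ¬?; ⌊_⌋; toWitness; fromWitness)
open import Relation.Unary using (Decidable)
open import Relation.Binary.PropositionalEquality
open import Algebra.Properties.CommutativeMonoid.Sum +-0-commutativeMonoid using (sum; sum-permute; sum-cong-≗)

-- In the code d = 2 + e; put Q = (d + 1)^2 + s. The obstacle is that each member may miss up to s
-- others, so every union bound carries an additive `s`, also inside a branching. It is harmless
-- because N₁ is at least n - t - 1, which exceeds a large multiple of Q: the summand s of Q pays
-- for these terms, and (d + 1)^2 pays for (d + 1) N₂, since N₂ is N₁ times (d - 1) / (n - t - 1).
-- The two entries of the maximum have separate sources. The number of t-subsets of a (t + 2)-set is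
-- the first one; it makes ℓ at most 3 N₁ / (4 (t + 1) (t + 2)), so counting through an almost cover
-- of t + 2 points stays cheap. The second, (k - t) / 2, keeps the pair term of the Bonferroni bound
-- for the extremal pattern below N₁ / 2. Larger almost covers are no worse: one more point costs a
-- factor of at most (t + 3) (d + 2) / 3, and the drop in the number of k-sets through it outweighs
-- this. Near the extremal pattern size alone decides: three parts of the family have upper bounds
-- that add up to the lower bound, so all three are attained.

-- Sealed, since otherwise the type checker unfolds n C k into factorials.
abstract

  binom : ℕ → ℕ → ℕ
  binom n k = n C k

  binom≡C : ∀ n k → binom n k ≡ n C k
  binom≡C n k = refl

  binom-zero : ∀ n → binom n 0 ≡ 1
  binom-zero n = refl

  binom-empty : ∀ k → binom 0 (suc k) ≡ 0
  binom-empty k = refl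

  binom-suc : ∀ n k → binom (suc n) (suc k) ≡ binom n k + binom n (suc k)
  binom-suc n k = sym (nCk+nC[k+1]≡[n+1]C[k+1] n k)

-- Binomial inequalities

-- A certificate for linear arithmetic without subtraction: `L ≤ R` is a nonnegative combination of
-- the hypotheses, `c` is the slack left over, and the identity is left to the ring solver.
by-slack : ∀ {L R} a b c → L ≤ R → a + R + c ≡ b + L → a ≤ b
by-slack {L} {R} a b c L≤R eq = +-cancelʳ-≤ L a b (begin
  a + L      ≤⟨ +-monoʳ-≤ a L≤R ⟩
  a + R      ≤⟨ m≤m+n (a + R) c ⟩
  a + R + c  ≡⟨ eq ⟩
  b + L      ∎)
  where open ≤-Reasoning

by-surplus : ∀ a b c → a + c ≡ b → a ≤ b
by-surplus a b c eq = ≤-trans (m≤m+n a c) (≤-reflexive eq)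

infixr 4 _⊹_
infix  5 _⊛_

-- +-mono-≤ and *-monoʳ-≤ with types that the ring solver can read.
_⊹_ : ∀ {a b c d} → a ≤ b → c ≤ d → a + c ≤ b + d
_⊹_ = +-mono-≤

_⊛_ : ∀ k {a b} → a ≤ b → k * a ≤ k * b
_⊛_ = *-monoʳ-≤

binom-sym : ∀ a b → binom (a + b) b ≡ binom (a + b) a
binom-sym a b = begin
  binom (a + b) b            ≡⟨ binom≡C (a + b) b ⟩
  (a + b) C b                ≡⟨ nCk≡nC[n∸k] (m≤n+m b a) ⟩
  (a + b) C (a + b ∸ b)      ≡⟨ cong ((a + b) C_) (m+n∸n≡m a b) ⟩
  (a + b) C a                ≡⟨ sym (binom≡C (a + b) a) ⟩
  binom (a + b) a            ∎
  where open ≡-Reasoning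

binom-mono : ∀ n k → binom n k ≤ binom (suc n) k
binom-mono n zero    = ≤-reflexive (trans (binom-zero n) (sym (binom-zero (suc n))))
binom-mono n (suc k) = ≤-trans (m≤n+m (binom n (suc k)) (binom n k)) (≤-reflexive (sym (binom-suc n k)))

binom-one : ∀ n → binom n 1 ≡ n
binom-one n = trans (binom≡C n 1) (nC1≡n n)

binom-absorb : ∀ n k → suc k * binom (suc n) (suc k) ≡ suc n * binom n k
binom-absorb zero    zero    = trans (cong (1 *_) (binom-one 1)) (cong (1 *_) (sym (binom-zero 0)))
binom-absorb zero    (suc k) = begin
  (2 + k) * binom 1 (2 + k)                        ≡⟨ cong ((2 + k) *_) (binom-suc 0 (suc k)) ⟩
  (2 + k) * (binom 0 (suc k) + binom 0 (2 + k))    ≡⟨ cong₂ (λ x y → (2 + k) * (x + y)) (binom-empty k) (binom-empty (suc k)) ⟩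
  (2 + k) * 0                                      ≡⟨ *-zeroʳ (2 + k) ⟩
  0                                                ≡⟨ cong (1 *_) (sym (binom-empty k)) ⟩
  1 * binom 0 (suc k)                              ∎
  where open ≡-Reasoning
binom-absorb (suc n) zero    = begin
  1 * binom (2 + n) 1       ≡⟨ cong (1 *_) (binom-one (2 + n)) ⟩
  1 * (2 + n)               ≡⟨ *-comm 1 (2 + n) ⟩
  (2 + n) * 1               ≡⟨ cong ((2 + n) *_) (sym (binom-zero (suc n))) ⟩
  (2 + n) * binom (suc n) 0 ∎
  where open ≡-Reasoning
binom-absorb (suc n) (suc k) = begin
  (2 + k) * binom (2 + n) (2 + k)  ≡⟨ cong ((2 + k) *_) (binom-suc (suc n) (suc k)) ⟩
  (2 + k) * (x + y)                ≡⟨ expand k x y ⟩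
  suc k * x + x + (2 + k) * y      ≡⟨ cong₂ (λ a b → a + x + b) (binom-absorb n k) (binom-absorb n (suc k)) ⟩
  suc n * z + x + suc n * w        ≡⟨ collect n x z w ⟩
  x + suc n * (z + w)              ≡⟨ cong (λ a → x + suc n * a) (sym (binom-suc n k)) ⟩
  (2 + n) * x                      ∎
  where
  open ≡-Reasoning
  x = binom (suc n) (suc k)
  y = binom (suc n) (2 + k)
  z = binom n k
  w = binom n (suc k)
  expand : ∀ k x y → (2 + k) * (x + y) ≡ suc k * x + x + (2 + k) * y
  expand = solve-∀
  collect : ∀ n x z w → suc n * z + x + suc n * w ≡ x + suc n * (z + w)
  collect = solve-∀

binom-pos : ∀ n k → k ≤ n → 1 ≤ binom n k
binom-pos n       zero    _         = ≤-reflexive (sym (binom-zero n))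
binom-pos (suc n) (suc k) (s≤s k≤n) = ≤-trans (binom-pos n k k≤n)
  (≤-trans (m≤m+n _ _) (≤-reflexive (sym (binom-suc n k))))

binom-≥ : ∀ n k → suc k < n → n ≤ binom n (suc k)
binom-≥ n       zero    _ = ≤-reflexive (sym (binom-one n))
binom-≥ (suc n) (suc k) (s≤s k<n) = begin
  suc n                              ≡⟨ +-comm 1 n ⟩
  n + 1                              ≤⟨ +-mono-≤ (binom-≥ n k k<n) (binom-pos n (2 + k) k<n) ⟩
  binom n (suc k) + binom n (2 + k)  ≡⟨ sym (binom-suc n (suc k)) ⟩
  binom (suc n) (2 + k)              ∎
  where open ≤-Reasoning

binom-two : ∀ t → 2 * binom (2 + t) 2 ≡ (t + 1) * (t + 2)
binom-two t = begin
  2 * binom (2 + t) 2      ≡⟨ binom-absorb (suc t) 1 ⟩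
  (2 + t) * binom (1 + t) 1  ≡⟨ cong ((2 + t) *_) (binom-one (1 + t)) ⟩
  (2 + t) * (1 + t)        ≡⟨ solve (t ∷ []) ⟩
  (t + 1) * (t + 2)        ∎
  where open ≡-Reasoning

-- A doubled Bonferroni bound for the union of j + 2 stars, written without subtraction.
binom-bonferroni : ∀ a e j →
  2 * binom a (2 + e) + 2 * (2 + j) * binom (suc (j + a)) (suc e) ≤
  2 * binom (2 + (j + a)) (2 + e) + (1 + j) * (2 + j) * binom (j + a) e
binom-bonferroni a e zero = ≤-reflexive (begin
  2 * z + 4 * binom (suc a) (suc e)   ≡⟨ cong (λ u → 2 * z + 4 * u) (binom-suc a e) ⟩
  2 * z + 4 * (x + y)                 ≡⟨ arrange x y z ⟩
  2 * (x + y + (y + z)) + 1 * 2 * x   ≡⟨ cong (λ u → 2 * u + 1 * 2 * x) (sym eq) ⟩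
  2 * binom (2 + a) (2 + e) + 1 * 2 * x  ∎)
  where
  open ≡-Reasoning
  x = binom a e
  y = binom a (suc e)
  z = binom a (2 + e)
  eq : binom (2 + a) (2 + e) ≡ x + y + (y + z)
  eq = trans (binom-suc (suc a) (suc e)) (cong₂ _+_ (binom-suc a e) (binom-suc a (suc e)))
  arrange : ∀ x y z → 2 * z + 4 * (x + y) ≡ 2 * (x + y + (y + z)) + 1 * 2 * x
  arrange = solve-∀
binom-bonferroni a e (suc j) = subst (λ u → 2 * z + 2 * (3 + j) * v ≤ 2 * u + (2 + j) * (3 + j) * x)
  (sym (binom-suc (2 + (j + a)) (suc e)))
  (step j x y z v w p (binom-mono (j + a) e) (binom-suc (suc (j + a)) e) (binom-bonferroni a e j))
  where
  x = binom (suc (j + a)) e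
  y = binom (j + a) e
  z = binom a (2 + e)
  v = binom (2 + (j + a)) (suc e)
  w = binom (2 + (j + a)) (2 + e)
  p = binom (suc (j + a)) (suc e)
  step : ∀ j x y z v w p → y ≤ x → v ≡ x + p →
    2 * z + 2 * (2 + j) * p ≤ 2 * w + (1 + j) * (2 + j) * y →
    2 * z + 2 * (3 + j) * v ≤ 2 * (v + w) + (2 + j) * (3 + j) * x
  step j x y z _ w p y≤x refl ih =
    by-slack _ _ 0 (ih ⊹ (1 + j) * (2 + j) ⊛ y≤x)
      (solve (j ∷ x ∷ y ∷ z ∷ w ∷ p ∷ []))

-- Below, k = t + 2 + e and n = t + 2 + m, while N₁ and N₂ are the numbers of
-- k-subsets through t + 1 and through t + 2 given points.

-- Multiplying by `suc m` makes the ratio of `N₂` to `N₁` exact, and `suc m ≤ N₁` turns the additive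
-- `s` into a multiple of `N₁`.
scale-light : ∀ t e s m N₁ N₂ → suc m * N₂ ≡ (1 + e) * N₁ → suc m ≤ N₁ →
  4 * ((t + 1) * (t + 2)) * ((3 + e) * (3 + e) + s) ≤ 3 * suc m →
  4 * ((t + 1) * (t + 2)) * (s + (3 + e) * N₂) ≤ 3 * N₁
scale-light t e s m N₁ N₂ ratio m≤N₁ h = *-cancelˡ-≤ (suc m) (begin
  suc m * (4 * ((t + 1) * (t + 2)) * (s + (3 + e) * N₂))
    ≡⟨ solve (t ∷ e ∷ s ∷ m ∷ N₂ ∷ []) ⟩
  4 * ((t + 1) * (t + 2)) * (s * suc m + (3 + e) * (suc m * N₂))
    ≡⟨ cong (λ x → 4 * ((t + 1) * (t + 2)) * (s * suc m + (3 + e) * x)) ratio ⟩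
  4 * ((t + 1) * (t + 2)) * (s * suc m + (3 + e) * ((1 + e) * N₁))
    ≤⟨ *-monoʳ-≤ (4 * ((t + 1) * (t + 2)))
        (+-mono-≤ (*-monoʳ-≤ s m≤N₁) (*-monoʳ-≤ (3 + e) (*-monoˡ-≤ N₁ (+-monoˡ-≤ e (s≤s {n = 2} z≤n))))) ⟩
  4 * ((t + 1) * (t + 2)) * (s * N₁ + (3 + e) * ((3 + e) * N₁))
    ≡⟨ solve (t ∷ e ∷ s ∷ N₁ ∷ []) ⟩
  4 * ((t + 1) * (t + 2)) * ((3 + e) * (3 + e) + s) * N₁
    ≤⟨ *-monoˡ-≤ N₁ h ⟩
  3 * suc m * N₁
    ≡⟨ solve (m ∷ N₁ ∷ []) ⟩
  suc m * (3 * N₁) ∎)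
  where open ≤-Reasoning

-- The left side is twice the pair term in the Bonferroni bound for d + 1 stars.
scale-pairs : ∀ e s m N₁ N₂ → suc m * N₂ ≡ (1 + e) * N₁ →
  4 * (2 + e) * ((3 + e) * (3 + e) + s) ≤ 3 * suc m → (2 + e) * (3 + e) * N₂ ≤ N₁
scale-pairs e s m N₁ N₂ ratio h = *-cancelˡ-≤ (suc m) (begin
  suc m * ((2 + e) * (3 + e) * N₂)    ≡⟨ solve (e ∷ m ∷ N₂ ∷ []) ⟩
  (2 + e) * (3 + e) * (suc m * N₂)    ≡⟨ cong ((2 + e) * (3 + e) *_) ratio ⟩
  (2 + e) * (3 + e) * ((1 + e) * N₁)  ≡⟨ solve (e ∷ N₁ ∷ []) ⟩
  (2 + e) * (3 + e) * (1 + e) * N₁    ≤⟨ *-monoˡ-≤ N₁ (*-cancelˡ-≤ 3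
      (by-slack (3 * ((2 + e) * (3 + e) * (1 + e))) (3 * suc m) ((2 + e) * (3 + e) * (9 + e) + 4 * (2 + e) * s) h (solve (e ∷ s ∷ m ∷ [])))) ⟩
  suc m * N₁                          ∎)
  where open ≤-Reasoning

-- Here d = 3 + r + j. After doubling, the `s` part and the `Y` part are each paid by 3 (d + 1) `X`:
-- the former because (t + 3) s is at most `X`, the latter by the ratio of `Y` to `X`.
scale-step : ∀ t s r j q X Y → suc r * X ≡ suc q * Y → suc q ≤ X →
  (t + 3) * ((4 + r + j) * (4 + r + j) + s) + r ≤ q →
  (t + 3) * (5 + r + j) * (s + (4 + r + j) * Y) ≤ 3 * (s + (4 + r + j) * X)
scale-step t s r j q X Y ratio q≤X h = *-cancelˡ-≤ 2 (begin
  2 * ((t + 3) * (5 + r + j) * (s + (4 + r + j) * Y))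
    ≡⟨ solve (t ∷ s ∷ r ∷ j ∷ Y ∷ []) ⟩
  2 * ((5 + r + j) * ((t + 3) * s)) + (4 + r + j) * (2 * ((t + 3) * (5 + r + j) * Y))
    ≤⟨ +-mono-≤ part₁ (*-monoʳ-≤ (4 + r + j) part₂) ⟩
  3 * (4 + r + j) * X + (4 + r + j) * (3 * X)
    ≤⟨ by-surplus _ _ (6 * s) (solve (s ∷ r ∷ j ∷ X ∷ [])) ⟩
  2 * (3 * (s + (4 + r + j) * X)) ∎)
  where
  open ≤-Reasoning
  s≤X : (t + 3) * s ≤ X
  s≤X = ≤-trans (by-slack ((t + 3) * s) (suc q) ((t + 3) * ((4 + r + j) * (4 + r + j)) + r + 1) h (solve (t ∷ s ∷ r ∷ j ∷ q ∷ []))) q≤X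
  part₁ : 2 * ((5 + r + j) * ((t + 3) * s)) ≤ 3 * (4 + r + j) * X
  part₁ = begin
    2 * ((5 + r + j) * ((t + 3) * s))  ≤⟨ *-monoʳ-≤ 2 (*-monoʳ-≤ (5 + r + j) s≤X) ⟩
    2 * ((5 + r + j) * X)              ≤⟨ by-surplus _ _ ((2 + r + j) * X) (solve (r ∷ j ∷ X ∷ [])) ⟩
    3 * (4 + r + j) * X                ∎
  part₂ : 2 * ((t + 3) * (5 + r + j) * Y) ≤ 3 * X
  part₂ = *-cancelˡ-≤ (suc r) (begin
    suc r * (2 * ((t + 3) * (5 + r + j) * Y))
      ≡⟨ solve (t ∷ r ∷ j ∷ Y ∷ []) ⟩
    2 * ((t + 3) * (suc r * (5 + r + j))) * Y
      ≤⟨ *-monoˡ-≤ Y (by-slack (2 * ((t + 3) * (suc r * (5 + r + j)))) (3 * suc q)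
          ((t + 3) * (38 + 12 * r + r * r + 22 * j + 3 * (j * j) + 4 * (r * j) + 3 * s) + 3 * r + 3)
          (3 ⊛ h) (solve (t ∷ s ∷ r ∷ j ∷ q ∷ []))) ⟩
    3 * suc q * Y          ≡⟨ *-assoc 3 (suc q) Y ⟩
    3 * (suc q * Y)        ≡⟨ cong (3 *_) (sym ratio) ⟩
    3 * (suc r * X)        ≡⟨ solve (r ∷ X ∷ []) ⟩
    suc r * (3 * X)        ∎)

-- The binomial factor grows by (3 + j + t) / (3 + j), which is at most (t + 3) / 3 with equality at
-- j = 0; this is where the t + 3 and the 3 in the hypothesis come from.
scale-cover : ∀ t j d P B B′ Z Z′ → (3 + j) * B′ ≡ (3 + (j + t)) * B →
  (t + 3) * d * Z′ ≤ 3 * Z → B′ * (d * P) * Z′ ≤ B * P * Z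
scale-cover t j d P B B′ Z Z′ ratio h = *-cancelˡ-≤ (3 * (3 + j)) (begin
  3 * (3 + j) * (B′ * (d * P) * Z′)
    ≡⟨ arrange₁ j d P B′ Z′ ⟩
  3 * ((3 + j) * B′) * (d * P * Z′)
    ≡⟨ cong (λ x → 3 * x * (d * P * Z′)) ratio ⟩
  3 * ((3 + (j + t)) * B) * (d * P * Z′)
    ≤⟨ *-monoˡ-≤ (d * P * Z′) (by-surplus (3 * ((3 + (j + t)) * B)) ((t + 3) * (3 + j) * B) (t * j * B) (solve (t ∷ j ∷ B ∷ []))) ⟩
  (t + 3) * (3 + j) * B * (d * P * Z′)
    ≡⟨ arrange₂ t j d P B Z′ ⟩
  (3 + j) * B * P * ((t + 3) * d * Z′)
    ≤⟨ *-monoʳ-≤ ((3 + j) * B * P) h ⟩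
  (3 + j) * B * P * (3 * Z)
    ≡⟨ arrange₃ j P B Z ⟩
  3 * (3 + j) * (B * P * Z) ∎)
  where
  open ≤-Reasoning
  arrange₁ : ∀ j d P B′ Z′ → 3 * (3 + j) * (B′ * (d * P) * Z′) ≡ 3 * ((3 + j) * B′) * (d * P * Z′)
  arrange₁ = solve-∀
  arrange₂ : ∀ t j d P B Z′ → (t + 3) * (3 + j) * B * (d * P * Z′) ≡ (3 + j) * B * P * ((t + 3) * d * Z′)
  arrange₂ = solve-∀
  arrange₃ : ∀ j P B Z → (3 + j) * B * P * (3 * Z) ≡ 3 * (3 + j) * (B * P * Z)
  arrange₃ = solve-∀

-- The three ways in which the family could fail to be the extremal one, each
-- excluded by comparison with an admissible family of size h + s + 1.
too-small-sunflower : ∀ t e s N ℓ h z → 4 * (t + 1) * ℓ ≤ N →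
  (5 + 2 * e) * N ≤ 2 * h → h + s + 1 ≤ z → ¬ (z ≤ s + (ℓ + (2 + e) * N) + t * ℓ)
too-small-sunflower t e s N ℓ h z thin big lower upper = <⇒≱ (s≤s {n = 3} z≤n)
  (by-slack 4 0 N
    (thin ⊹ 2 ⊛ big ⊹ 4 ⊛ lower ⊹ 4 ⊛ upper)
    (solve (t ∷ e ∷ s ∷ N ∷ ℓ ∷ h ∷ z ∷ [])))

-- By `s ≤ ℓ` the last summand is at most (t + 1) (4 + e) ℓ, hence at most (4 + e) N / 4. The
-- certificate ends in the absurd 4 ≤ 0, whose 4 is the scaled unit of `h + s + 1 ≤ z`.
too-small-kernel : ∀ t e s N ℓ h z → 4 * (t + 1) * ℓ ≤ N → s ≤ ℓ →
  (5 + 2 * e) * N ≤ 2 * h → h + s + 1 ≤ z → ¬ (z ≤ N + (s + (t + 1) * (s + (3 + e) * ℓ)))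
too-small-kernel t e s N ℓ h z thin s≤ℓ big lower upper = <⇒≱ (s≤s {n = 3} z≤n)
  (by-slack 4 0 ((2 + 3 * e) * N)
    ((4 + e) ⊛ thin ⊹ 4 * (t + 1) ⊛ s≤ℓ ⊹ 2 ⊛ big ⊹ 4 ⊛ lower ⊹ 4 ⊛ upper)
    (solve (t ∷ e ∷ s ∷ N ∷ ℓ ∷ h ∷ z ∷ [])))

too-small-cover : ∀ t e s N ℓ h z b → 2 * b ≡ (t + 1) * (t + 2) →
  4 * ((t + 1) * (t + 2)) * ℓ ≤ 3 * N →
  (5 + 2 * e) * N ≤ 2 * h → h + s + 1 ≤ z → ¬ (z ≤ s + b * (4 + e) * ℓ)
too-small-cover t e s N ℓ h z b eq light big lower upper = <⇒≱ (s≤s {n = 7} z≤n)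
  (by-slack 8 0 ((8 + 5 * e) * N)
    ((4 + e) ⊛ light′ ⊹ 4 ⊛ big ⊹ 8 ⊛ lower ⊹ 8 ⊛ upper)
    (solve (e ∷ s ∷ N ∷ ℓ ∷ h ∷ z ∷ b ∷ [])))
  where
  light′ : 4 * (2 * b) * ℓ ≤ 3 * N
  light′ = subst (λ x → 4 * x * ℓ ≤ 3 * N) (sym eq) light

-- Since t = `suc u` is positive, t + 2 is at least 3 and cancels the 3 on the right.
thin-light : ∀ u N ℓ → 4 * ((suc u + 1) * (suc u + 2)) * ℓ ≤ 3 * N → 4 * (suc u + 1) * ℓ ≤ N
thin-light u N ℓ light = *-cancelˡ-≤ 3
  (by-slack (3 * (4 * (suc u + 1) * ℓ)) (3 * N) (4 * (u + 2) * u * ℓ) light (solve (u ∷ N ∷ ℓ ∷ [])))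

-- The bounds are wanted in `suc m` = n - t - 1. Weakening the constant 3/2 to 4/3 pays for the t +
-- 1 points removed, because t + 2 ≤ `M` and Q is at least 9.
ground-size : ∀ n u e s M → (suc u + 2) * (suc u + 1) ≤ M → 2 + e ≤ M →
  3 * M * ((3 + e) * (3 + e) + s) ≤ 2 * n → ∃ λ m →
  n ≡ suc (suc u) + suc m ×
  4 * ((suc u + 1) * (suc u + 2)) * ((3 + e) * (3 + e) + s) ≤ 3 * suc m ×
  4 * (2 + e) * ((3 + e) * (3 + e) + s) ≤ 3 * suc m ×
  2 + e + (suc u + 3) * ((3 + e) * (3 + e) + s) ≤ suc m
ground-size n u e s M c₂≤M d≤M h =
  m , n≡ , ≤-trans (*-monoˡ-≤ Q (*-monoʳ-≤ 4 c₂≤M′)) big , ≤-trans (*-monoˡ-≤ Q (*-monoʳ-≤ 4 d≤M)) big ,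
  *-cancelˡ-≤ 3 (≤-trans small big)
  where
  Q = (3 + e) * (3 + e) + s
  c₂≤M′ : (suc u + 1) * (suc u + 2) ≤ M
  c₂≤M′ = ≤-trans (≤-reflexive (*-comm (suc u + 1) (suc u + 2))) c₂≤M
  u<M : 3 + u ≤ M
  u<M = ≤-trans (by-surplus (3 + u) ((suc u + 2) * (suc u + 1)) (u * u + 4 * u + 3) (solve (u ∷ []))) c₂≤M
  u<n : 3 + u ≤ n
  u<n = *-cancelˡ-≤ 2 (begin
    2 * (3 + u)                     ≤⟨ 2 ⊛ u<M ⟩
    2 * M                           ≤⟨ by-surplus _ _ (M * (25 + 18 * e + 3 * (e * e) + 3 * s)) (solve (e ∷ s ∷ M ∷ [])) ⟩
    3 * M * ((3 + e) * (3 + e) + s) ≤⟨ h ⟩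
    2 * n                           ∎)
    where open ≤-Reasoning
  m = n ∸ (3 + u)
  n≡ : n ≡ suc (suc u) + suc m
  n≡ = trans (sym (m+[n∸m]≡n u<n)) (sym (+-suc (2 + u) m))
  big : 4 * M * Q ≤ 3 * suc m
  big = *-cancelˡ-≤ 2 (combine u e s M m (subst (λ x → 3 * M * Q ≤ 2 * x) n≡ h) u<M)
    where
    combine : ∀ u e s M m → 3 * M * ((3 + e) * (3 + e) + s) ≤ 2 * (suc (suc u) + suc m) → 3 + u ≤ M →
      2 * (4 * M * ((3 + e) * (3 + e) + s)) ≤ 2 * (3 * suc m)
    combine u e s M m h u<M = by-slack _ _ (6 + M * (3 + 6 * e + e * e + s))
      (3 ⊛ h ⊹ 6 ⊛ u<M) (solve (u ∷ e ∷ s ∷ M ∷ m ∷ []))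
  -- For positive t, (t + 1) (t + 2) exceeds t + 3 by at least 2, so a spare copy of Q absorbs 2 +
  -- e.
  small : 3 * (2 + e + (suc u + 3) * Q) ≤ 4 * M * Q
  small = begin
    3 * (2 + e + (suc u + 3) * ((3 + e) * (3 + e) + s))
      ≤⟨ by-surplus _ _ (3 * ((u * u + 4 * u + 1) * ((3 + e) * (3 + e) + s) + 7 + 5 * e + e * e + s))
           (solve (u ∷ e ∷ s ∷ [])) ⟩
    3 * ((suc u + 1) * (suc u + 2) * ((3 + e) * (3 + e) + s))
      ≤⟨ *-monoʳ-≤ 3 (*-monoˡ-≤ Q c₂≤M′) ⟩
    3 * (M * Q)                    ≤⟨ *-monoˡ-≤ (M * Q) (n≤1+n 3) ⟩
    4 * (M * Q)                    ≡⟨ sym (*-assoc 4 M Q) ⟩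
    4 * M * Q                      ∎
    where open ≤-Reasoning

-- Numerical consequences of a large ground set

module Numbers (t e s m : ℕ)
  (room : 2 + e + (t + 3) * ((3 + e) * (3 + e) + s) ≤ suc m)
  (wide : 4 * (2 + e) * ((3 + e) * (3 + e) + s) ≤ 3 * suc m) where

  n k N₁ N₂ : ℕ
  n = suc t + suc m
  k = t + (2 + e)
  N₁ = binom (suc m) (suc e)
  N₂ = binom m e

  n-shift : ∀ j → n ∸ (2 + (j + t)) ≡ m ∸ j
  n-shift j = trans (cong₂ (λ a b → suc a ∸ (2 + b)) (+-suc t m) (+-comm j t)) ([m+n]∸[m+o]≡n∸o t m j)

  k-shift : ∀ j → k ∸ (2 + (j + t)) ≡ e ∸ j
  k-shift j = trans (cong₂ (λ a b → a ∸ (2 + b)) (trans (+-suc t (suc e)) (cong suc (+-suc t e))) (+-comm j t))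
    ([m+n]∸[m+o]≡n∸o t e j)

  N-shift : ∀ j → binom (n ∸ (2 + (j + t))) (k ∸ (2 + (j + t))) ≡ binom (m ∸ j) (e ∸ j)
  N-shift j = cong₂ binom (n-shift j) (k-shift j)

  N₁-shift : binom (n ∸ suc t) (k ∸ suc t) ≡ N₁
  N₁-shift = cong₂ binom (m+n∸m≡n (suc t) (suc m))
    (trans (cong (_∸ suc t) (+-suc t (suc e))) (m+n∸m≡n t (suc e)))

  ratio : suc m * N₂ ≡ suc e * N₁
  ratio = sym (binom-absorb m e)

  e<m : 2 + e ≤ suc m
  e<m = ≤-trans (m≤m+n (2 + e) _) room

  Q-pos : 1 ≤ (t + 3) * ((3 + e) * (3 + e) + s)
  Q-pos = *-mono-≤ {1} (≤-trans (s≤s z≤n) (m≤n+m 3 t)) (s≤s z≤n)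

  m≤N₁ : suc m ≤ N₁
  m≤N₁ = binom-≥ (suc m) e e<m

  cover-step : ∀ j → suc j ≤ e → (t + 3) * (4 + e) * (s + (3 + e) * binom (m ∸ suc j) (e ∸ suc j)) ≤
               3 * (s + (3 + e) * binom (m ∸ j) (e ∸ j))
  cover-step j j<e with m≤n⇒∃[o]m+o≡n j<e | m≤n⇒∃[o]m+o≡n {suc j} {m} (≤-trans j<e (s≤s⁻¹ (≤-trans (n≤1+n _) e<m)))
  ... | r , e≡ | q , m≡ = go r q (trans (sym e≡) (cong suc (+-comm j r))) (trans (sym m≡) (cong suc (+-comm j q)))
    where
    go : ∀ r q → e ≡ suc (r + j) → m ≡ suc (q + j) → _
    go r q refl refl = subst₂ (λ a b → (t + 3) * (5 + (r + j)) * (s + (4 + (r + j)) * a) ≤ 3 * (s + (4 + (r + j)) * b))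
      (sym (cong₂ binom (m+n∸n≡m q j) (m+n∸n≡m r j)))
      (sym (cong₂ binom (m+n∸n≡m (suc q) j) (m+n∸n≡m (suc r) j)))
      (scale-step t s r j q (binom (suc q) (suc r)) (binom q r) (binom-absorb q r)
        (binom-≥ (suc q) r (s≤s (≤-trans (+-monoˡ-≤ r Q-pos) far-apart))) far-apart)
      where
      far-apart : (t + 3) * ((4 + r + j) * (4 + r + j) + s) + r ≤ q
      far-apart = by-slack _ _ 1 room (solve (t ∷ s ∷ r ∷ j ∷ q ∷ []))

  -- The estimate when a smallest almost cover has 2 + j + t points: the choice of a t-subset, 1 + j
  -- branchings that each absorb an `s`, and a final degree bound.
  bound : ℕ → ℕ
  bound j = binom (2 + (j + t)) (2 + j) * (4 + e) ^ (1 + j) *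
    (s + (3 + e) * binom (n ∸ (2 + (j + t))) (k ∸ (2 + (j + t))))

  bound-step : ∀ j → suc j ≤ e → bound (suc j) ≤ bound j
  bound-step j j<e = scale-cover t j (4 + e) ((4 + e) ^ (1 + j))
    (binom (2 + (j + t)) (2 + j)) (binom (3 + (j + t)) (3 + j))
    (s + (3 + e) * binom (n ∸ (2 + (j + t))) (k ∸ (2 + (j + t))))
    (s + (3 + e) * binom (n ∸ (3 + (j + t))) (k ∸ (3 + (j + t))))
    (binom-absorb (2 + (j + t)) (2 + j))
    (subst₂ (λ a b → (t + 3) * (4 + e) * (s + (3 + e) * a) ≤ 3 * (s + (3 + e) * b))
      (sym (N-shift (suc j))) (sym (N-shift j)) (cover-step j j<e))

  bound-≤ : ∀ j → j ≤ e → bound j ≤ bound 0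
  bound-≤ zero    _   = ≤-refl
  bound-≤ (suc j) j<e = ≤-trans (bound-step j j<e) (bound-≤ j (≤-trans (n≤1+n j) j<e))

  bound-zero : bound 0 ≡ binom (2 + t) 2 * (4 + e) * (s + (3 + e) * binom (n ∸ (2 + t)) (k ∸ (2 + t)))
  bound-zero = cong (λ x → binom (2 + t) 2 * x * (s + (3 + e) * binom (n ∸ (2 + t)) (k ∸ (2 + t)))) (*-identityʳ (4 + e))

  -- The number of points outside the (k + 1)-set of the extremal pattern.
  spare : ℕ
  spare = suc m ∸ (2 + e)

  spare≡ : n ∸ suc k ≡ spare
  spare≡ = trans (cong (_∸ k) (+-suc t m)) (trans (cong (_∸ k) (sym (+-suc t m))) ([m+n]∸[m+o]≡n∸o t (suc m) (2 + e)))

  room′ : (t + 3) * ((3 + e) * (3 + e) + s) ≤ spare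
  room′ = ≤-trans (≤-reflexive (sym (m+n∸m≡n (2 + e) _))) (∸-monoˡ-≤ (2 + e) room)

  s≤tips : s ≤ binom (n ∸ suc k) (2 + e)
  s≤tips = begin
    s                                     ≤⟨ m≤n+m s _ ⟩
    (3 + e) * (3 + e) + s                 ≤⟨ Q≤spare ⟩
    spare                                 ≤⟨ binom-≥ spare (1 + e) (≤-trans (≤-trans (m≤m*n (3 + e) (3 + e)) (m≤m+n _ s)) Q≤spare) ⟩
    binom spare (2 + e)                   ≡⟨ cong (λ a → binom a (2 + e)) (sym spare≡) ⟩
    binom (n ∸ suc k) (2 + e)             ∎
    where
    open ≤-Reasoning
    Q≤spare : (3 + e) * (3 + e) + s ≤ spare
    Q≤spare = ≤-trans (≤-trans (≤-reflexive (sym (*-identityˡ _)))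
      (*-monoˡ-≤ ((3 + e) * (3 + e) + s) {1} {t + 3} (≤-trans (s≤s z≤n) (m≤n+m 3 t)))) room′

  -- Here `h` counts the k-sets through t fixed points that contain at least one of d + 1 further
  -- points. Bonferroni gives at least (d + 1) N₁ minus the pair term, and `wide` bounds that term
  -- by N₁ / 2.
  stars-large : ∀ h → h + binom (n ∸ suc k) (2 + e) ≡ binom (n ∸ t) (2 + e) → (5 + 2 * e) * N₁ ≤ 2 * h
  stars-large h eq = combine e N₁ (binom (suc (e + spare)) e) h z (subst₂ (λ a b → 2 * z + 2 * (3 + e) * binom a (suc e) ≤
      2 * b + (2 + e) * (3 + e) * binom (suc (e + spare)) e)
      shift₁ (trans (cong (λ a → binom (suc a) (2 + e)) shift₁) (sym eq′)) (binom-bonferroni spare e (suc e)))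
      (subst (λ a → (2 + e) * (3 + e) * binom a e ≤ N₁) (sym shift₂) (scale-pairs e s m N₁ N₂ ratio wide))
    where
    z = binom spare (2 + e)
    shift₁ : suc (suc (e + spare)) ≡ suc m
    shift₁ = m+[n∸m]≡n e<m
    shift₂ : suc (e + spare) ≡ m
    shift₂ = suc-injective shift₁
    eq′ : h + z ≡ binom (suc (suc m)) (2 + e)
    eq′ = trans (cong (λ a → h + binom a (2 + e)) (sym spare≡)) (trans eq (cong (λ a → binom a (2 + e))
      (trans (cong (_∸ t) (sym (+-suc t (suc m)))) (m+n∸m≡n t (2 + m)))))
    combine : ∀ e N₁ X h z → 2 * z + 2 * (3 + e) * N₁ ≤ 2 * (h + z) + (2 + e) * (3 + e) * X →
      (2 + e) * (3 + e) * X ≤ N₁ → (5 + 2 * e) * N₁ ≤ 2 * h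
    combine e N₁ X h z le₁ le₂ = by-slack _ _ 0 (le₁ ⊹ le₂) (solve (e ∷ N₁ ∷ X ∷ h ∷ z ∷ []))

-- Opened only now, because an overloaded _∷_ stalls the ring solver above.
open import Data.Vec using (tabulate; lookup; []; _∷_; here)

-- Counting subsets

countL-++ : ∀ {n} (p : Subset n → Bool) xs ys → countL p (xs ++ ys) ≡ countL p xs + countL p ys
countL-++ p []       ys = refl
countL-++ p (x ∷ xs) ys with p x
... | true  = cong suc (countL-++ p xs ys)
... | false = countL-++ p xs ys

countL-map : ∀ {m n} (p : Subset n → Bool) (f : Subset m → Subset n) xs →
             countL p (map f xs) ≡ countL (p ∘ f) xs
countL-map p f []       = refl
countL-map p f (x ∷ xs) with p (f x)
... | true  = cong suc (countL-map p f xs)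
... | false = countL-map p f xs

count-suc : ∀ {n} (p : Subset (suc n) → Bool) →
            count p ≡ count (p ∘ (true ∷_)) + count (p ∘ (false ∷_))
count-suc {n} p = trans (countL-++ p (map (true ∷_) (allSubsets n)) _)
  (cong₂ _+_ (countL-map p (true ∷_) (allSubsets n)) (countL-map p (false ∷_) (allSubsets n)))

countL-split : ∀ {n} {p q r : Subset n → Bool} → (∀ F → T (p F) → T (q F) ⊎ T (r F)) →
               ∀ xs → countL p xs ≤ countL q xs + countL r xs
countL-split                 h []       = z≤n
countL-split {p = p} {q} {r} h (x ∷ xs) with p x | q x | r x | h x
... | true  | true  | true  | _ = s≤s (≤-trans (countL-split h xs) (+-monoʳ-≤ (countL q xs) (n≤1+n _)))
... | true  | true  | false | _ = s≤s (countL-split h xs)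
... | true  | false | true  | _ = ≤-trans (s≤s (countL-split h xs)) (≤-reflexive (sym (+-suc (countL q xs) _)))
... | true  | false | false | g = ⊥-elim ([ id , id ]′ (g _))
... | false | true  | true  | _ = ≤-trans (countL-split h xs) (+-mono-≤ (n≤1+n (countL q xs)) (n≤1+n _))
... | false | true  | false | _ = ≤-trans (countL-split h xs) (n≤1+n _)
... | false | false | true  | _ = ≤-trans (countL-split h xs) (+-monoʳ-≤ (countL q xs) (n≤1+n _))
... | false | false | false | _ = countL-split h xs

countL-disjoint : ∀ {n} {p q r : Subset n → Bool} → (∀ F → T (p F) → T (r F)) →
                  (∀ F → T (q F) → T (r F)) → (∀ F → T (p F) → T (q F) → T false) →
                  ∀ xs → countL p xs + countL q xs ≤ countL r xs
countL-disjoint                 f g h []       = z≤n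
countL-disjoint {p = p} {q} {r} f g h (x ∷ xs) with p x | q x | r x | f x | g x | h x
... | true  | true  | _     | _  | _  | h′ = ⊥-elim (h′ _ _)
... | true  | false | true  | _  | _  | _  = s≤s (countL-disjoint f g h xs)
... | true  | false | false | f′ | _  | _  = ⊥-elim (f′ _)
... | false | true  | true  | _  | _  | _  =
  ≤-trans (≤-reflexive (+-suc (countL p xs) _)) (s≤s (countL-disjoint f g h xs))
... | false | true  | false | _  | g′ | _  = ⊥-elim (g′ _)
... | false | false | true  | _  | _  | _  = m≤n⇒m≤1+n (countL-disjoint f g h xs)
... | false | false | false | _  | _  | _  = countL-disjoint f g h xs

countL-exists : ∀ {n} (p : Subset n → Bool) xs → 0 < countL p xs → ∃ λ F → T (p F)
countL-exists p (x ∷ xs) lt with p x in eq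
... | true  = x , subst T (sym eq) _
... | false = countL-exists p xs lt

countL-false : ∀ {n} (xs : List (Subset n)) → countL (λ _ → false) xs ≡ 0
countL-false []       = refl
countL-false (x ∷ xs) = countL-false xs

countL-mono : ∀ {n} {p q : Subset n → Bool} → (∀ F → T (p F) → T (q F)) →
              ∀ xs → countL p xs ≤ countL q xs
countL-mono {q = q} h xs = ≤-trans (countL-split {q = q} {r = λ _ → false} (λ F → inj₁ ∘ h F) xs)
  (≤-reflexive (trans (cong (countL q xs +_) (countL-false xs)) (+-identityʳ _)))

-- Turns equality of sizes into equality of families. Each half of the cube must be full, because
-- neither can make up for a deficit in the other.
count-full : ∀ {n} {p q : Subset n → Bool} → (∀ F → T (p F) → T (q F)) →
             count q ≤ count p → ∀ F → T (q F) → T (p F)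
count-full {zero}  {p} {q} h le [] tq with p [] | q []
... | true  | _     = _
... | false | true  with () ← le
... | false | false = tq
count-full {suc n} {p} {q} h le (b ∷ F) tq =
  at b (subst₂ _≤_ (count-suc q) (count-suc p) le) F tq
  where
  side : ∀ c → count (p ∘ (c ∷_)) ≤ count (q ∘ (c ∷_))
  side c = countL-mono (λ G → h (c ∷ G)) (allSubsets n)
  at : ∀ c → count (q ∘ (true ∷_)) + count (q ∘ (false ∷_)) ≤
             count (p ∘ (true ∷_)) + count (p ∘ (false ∷_)) →
       ∀ G → T (q (c ∷ G)) → T (p (c ∷ G))
  at true  le′ = count-full (λ G → h (true ∷ G))
    (+-cancelʳ-≤ _ _ _ (≤-trans le′ (+-monoʳ-≤ _ (side false))))
  at false le′ = count-full (λ G → h (false ∷ G))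
    (+-cancelˡ-≤ _ _ _ (≤-trans le′ (+-monoˡ-≤ _ (side true))))

count-pos : ∀ {n} (p : Subset n → Bool) F → T (p F) → 0 < count p
count-pos {n} p F pF = ≰⇒> λ le →
  count-full {p = λ _ → false} (λ _ ()) (≤-trans le z≤n) F pF

count-selection : ∀ {n} (p : Family n) m → m ≤ count p →
                  Σ (Family n) λ q → (∀ F → T (q F) → T (p F)) × size q ≡ m
count-selection {n} p zero le = (λ _ → false) , (λ _ ()) , countL-false (allSubsets n)
count-selection {zero} p (suc m) le with p [] in eq
count-selection {zero} p (suc zero) le | true =
  p , (λ _ → id) , trans (cong (λ b → if b then 1 else 0) eq) refl
count-selection {zero} p (suc (suc m)) (s≤s ()) | true
count-selection {suc n} p m@(suc _) le with m ≤? count (p ∘ (true ∷_))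
... | yes m≤ = let q , q⊆p , eq = count-selection (p ∘ (true ∷_)) m m≤ in
  (λ { (true ∷ F) → q F ; (false ∷ F) → false }) ,
  (λ { (true ∷ F) → q⊆p F ; (false ∷ F) () }) ,
  trans (count-suc {n} _) (trans (cong₂ _+_ eq (countL-false (allSubsets n))) (+-identityʳ m))
... | no m≰ =
  let c = count (p ∘ (true ∷_))
      q , q⊆p , eq = count-selection (p ∘ (false ∷_)) (m ∸ c)
        (m≤n+o⇒m∸n≤o m c (≤-trans le (≤-reflexive (count-suc p)))) in
  (λ { (true ∷ F) → p (true ∷ F) ; (false ∷ F) → q F }) ,
  (λ { (true ∷ F) → id ; (false ∷ F) → q⊆p F }) ,
  trans (count-suc {n} _) (trans (cong (c +_) eq) (m+[n∸m]≡n (<⇒≤ (≰⇒> m≰))))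

-- Counting by decidable predicates lets a family be cut down with `×-dec`; `size-#` leads back to
-- Boolean families.
# : ∀ {n} {P : Subset n → Set} → Decidable P → ℕ
# P? = count (λ F → ⌊ P? F ⌋)

size-# : ∀ {n} (𝓕 : Family n) → size 𝓕 ≡ # (λ F → T? (𝓕 F))
size-# {n} 𝓕 = ≤-antisym (countL-mono (λ F → fromWitness) (allSubsets n))
                         (countL-mono (λ F → toWitness) (allSubsets n))

module _ {n : ℕ} {P Q : Subset n → Set} (P? : Decidable P) (Q? : Decidable Q) where

  #-mono : (∀ F → P F → Q F) → # P? ≤ # Q?
  #-mono h = countL-mono (λ F → fromWitness ∘ h F ∘ toWitness) (allSubsets n)

  #-full : (∀ F → P F → Q F) → # Q? ≤ # P? → ∀ F → Q F → P F
  #-full h le F QF = toWitness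
    (count-full (λ F → fromWitness ∘ h F ∘ toWitness) le F (fromWitness QF))

#-cong : ∀ {n} {P Q : Subset n → Set} (P? : Decidable P) (Q? : Decidable Q) →
         (∀ F → P F → Q F) → (∀ F → Q F → P F) → # P? ≡ # Q?
#-cong P? Q? f g = ≤-antisym (#-mono P? Q? f) (#-mono Q? P? g)

module _ {n : ℕ} {P Q R : Subset n → Set}
         (P? : Decidable P) (Q? : Decidable Q) (R? : Decidable R) where

  #-split : (∀ F → P F → Q F ⊎ R F) → # P? ≤ # Q? + # R?
  #-split h = countL-split
    (λ F PF → [ inj₁ ∘ fromWitness , inj₂ ∘ fromWitness ]′ (h F (toWitness PF))) (allSubsets n)

  #-disjoint : (∀ F → P F → R F) → (∀ F → Q F → R F) → (∀ F → P F → ¬ Q F) →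
               # P? + # Q? ≤ # R?
  #-disjoint f g h = countL-disjoint (λ F → fromWitness ∘ f F ∘ toWitness)
    (λ F → fromWitness ∘ g F ∘ toWitness) (λ F p q → h F (toWitness p) (toWitness q)) (allSubsets n)

module _ {n : ℕ} {P : Subset n → Set} (P? : Decidable P) where

  #-exists : 0 < # P? → ∃ P
  #-exists lt = let F , PF = countL-exists _ (allSubsets n) lt in F , toWitness PF

  #-pos : ∀ F → P F → 0 < # P?
  #-pos F PF = count-pos (λ F → ⌊ P? F ⌋) F (fromWitness PF)

  #-empty : (∀ F → ¬ P F) → # P? ≡ 0
  #-empty h with # P? in eq
  ... | zero  = refl
  ... | suc m = let F , PF = #-exists (≤-trans (s≤s z≤n) (≤-reflexive (sym eq))) in ⊥-elim (h F PF)

#-suc : ∀ {n} {P : Subset (suc n) → Set} (P? : Decidable P) →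
        # P? ≡ # (λ F → P? (true ∷ F)) + # (λ F → P? (false ∷ F))
#-suc {n} P? = count-suc {n} (λ F → ⌊ P? F ⌋)

_≟ₛ_ : ∀ {n} (F G : Subset n) → Dec (F ≡ G)
_≟ₛ_ = ≡-dec Bool._≟_

-- Induction on the source dimension: the two halves of the cube have disjoint images, so `Q` is cut
-- into the image of each half. The cut predicates are decidable by search over all subsets.
#-injection : ∀ {m n} {P : Subset m → Set} {Q : Subset n → Set}
              (P? : Decidable P) (Q? : Decidable Q) (f : Subset m → Subset n) →
              (∀ F → P F → Q (f F)) → (∀ {F G} → f F ≡ f G → F ≡ G) → # P? ≤ # Q?
#-injection {zero} P? Q? f h inj with P? []
... | yes p = #-pos Q? (f []) (h [] p)
... | no  _ = z≤n
#-injection {suc m} {P = P} {Q} P? Q? f h inj = begin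
  # P?                                                  ≡⟨ #-suc P? ⟩
  # (λ F → P? (true ∷ F)) + # (λ F → P? (false ∷ F))    ≤⟨ +-mono-≤ (half true) (half false) ⟩
  # (Q? ∩image true) + # (Q? ∩image false)              ≤⟨ #-disjoint (Q? ∩image true) (Q? ∩image false) Q?
    (λ _ → proj₁) (λ _ → proj₁) disj ⟩
  # Q?                                                  ∎
  where
  open ≤-Reasoning
  Q∩ : Bool → Subset _ → Set
  Q∩ b G = Q G × ∃ λ F → f (b ∷ F) ≡ G
  _∩image_ : Decidable Q → ∀ b → Decidable (Q∩ b)
  (R? ∩image b) G = R? G ×-dec anySubset? (λ F → f (b ∷ F) ≟ₛ G)
  half : ∀ b → # (λ F → P? (b ∷ F)) ≤ # (Q? ∩image b)
  half b = #-injection (λ F → P? (b ∷ F)) (Q? ∩image b) (λ F → f (b ∷ F))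
    (λ F p → h (b ∷ F) p , F , refl) (∷-injectiveʳ ∘ inj)
  disj : ∀ G → Q∩ true G → ¬ Q∩ false G
  disj G (_ , F , e) (_ , F′ , e′) with () ← ∷-injectiveˡ (inj (trans e (sym e′)))

Trace : ∀ {n} → ℕ → Subset n → Subset n → Subset n → Set
Trace k S R F = ∣ F ∣ ≡ k × F ∩ S ≡ R

trace? : ∀ {n} k (S R : Subset n) → Decidable (Trace k S R)
trace? k S R F = (∣ F ∣ ≟ k) ×-dec ((F ∩ S) ≟ₛ R)

-- A single count serves all exact enumerations: sets over `R` (take S = R), tips (S = W), and
-- subsets of `W` (prescribe an empty trace on its complement).
#-trace : ∀ {n} k (S R : Subset n) → R ∩ S ≡ R → ∣ R ∣ ≤ k →
          # (trace? k S R) ≡ binom (n ∸ ∣ S ∣) (k ∸ ∣ R ∣)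
#-trace zero    []          []          _   _  = sym (binom-zero 0)
#-trace (suc k) []          []          _   _  = sym (binom-empty k)
#-trace k       (true ∷ S)  (false ∷ R) R⊆S le = trans (#-suc (trace? k (true ∷ S) (false ∷ R)))
  (cong₂ _+_ (#-empty (λ F → trace? k (true ∷ S) (false ∷ R) (true ∷ F)) λ { F (_ , ()) })
    (trans (#-cong (λ F → trace? k (true ∷ S) (false ∷ R) (false ∷ F)) (trace? k S R)
      (λ { F (c , e) → c , ∷-injectiveʳ e }) (λ { F (c , e) → c , cong (false ∷_) e }))
    (#-trace k S R (∷-injectiveʳ R⊆S) le)))
#-trace (suc k) (true ∷ S)  (true ∷ R)  R⊆S (s≤s le) = trans (#-suc (trace? (suc k) (true ∷ S) (true ∷ R)))
  (trans (cong₂ _+_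
    (trans (#-cong (λ F → trace? (suc k) (true ∷ S) (true ∷ R) (true ∷ F)) (trace? k S R)
      (λ { F (c , e) → suc-injective c , ∷-injectiveʳ e }) (λ { F (c , e) → cong suc c , cong (true ∷_) e }))
    (#-trace k S R (∷-injectiveʳ R⊆S) le))
    (#-empty (λ F → trace? (suc k) (true ∷ S) (true ∷ R) (false ∷ F)) λ { F (_ , ()) })) (+-identityʳ _))
#-trace {suc n} zero (false ∷ S) (false ∷ R) R⊆S le = trans (#-suc (trace? 0 (false ∷ S) (false ∷ R)))
  (cong₂ _+_ (#-empty (λ F → trace? 0 (false ∷ S) (false ∷ R) (true ∷ F)) λ { F (() , _) })
    (trans (#-cong (λ F → trace? 0 (false ∷ S) (false ∷ R) (false ∷ F)) (trace? 0 S R)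
      (λ { F (c , e) → c , ∷-injectiveʳ e }) (λ { F (c , e) → c , cong (false ∷_) e }))
    (trans (#-trace 0 S R (∷-injectiveʳ R⊆S) le)
      (trans (trans (cong (binom (n ∸ ∣ S ∣)) (0∸n≡0 ∣ R ∣)) (binom-zero (n ∸ ∣ S ∣)))
        (sym (trans (cong (binom (suc n ∸ ∣ S ∣)) (0∸n≡0 ∣ R ∣)) (binom-zero (suc n ∸ ∣ S ∣))))))))
#-trace {suc n} (suc k) (false ∷ S) (false ∷ R) R⊆S le = trans (#-suc (trace? (suc k) (false ∷ S) (false ∷ R)))
  (trans (cong₂ _+_ (#-cong (λ F → trace? (suc k) (false ∷ S) (false ∷ R) (true ∷ F)) (trace? k S R)
       (λ { F (c , e) → suc-injective c , ∷-injectiveʳ e }) (λ { F (c , e) → cong suc c , cong (false ∷_) e }))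
     (trans (#-cong (λ F → trace? (suc k) (false ∷ S) (false ∷ R) (false ∷ F)) (trace? (suc k) S R)
       (λ { F (c , e) → c , ∷-injectiveʳ e }) (λ { F (c , e) → c , cong (false ∷_) e }))
      (#-trace (suc k) S R (∷-injectiveʳ R⊆S) le)))
    (trans rest (cong (λ m → binom m (suc k ∸ ∣ R ∣)) (sym (+-∸-assoc 1 (∣p∣≤n S))))))
  where
  rest : # (trace? k S R) + binom (n ∸ ∣ S ∣) (suc k ∸ ∣ R ∣) ≡ binom (suc (n ∸ ∣ S ∣)) (suc k ∸ ∣ R ∣)
  rest with ∣ R ∣ ≤? k
  ... | yes le′ rewrite +-∸-assoc 1 le′ = trans (cong (_+ binom (n ∸ ∣ S ∣) (suc (k ∸ ∣ R ∣))) (#-trace k S R (∷-injectiveʳ R⊆S) le′))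
          (sym (binom-suc (n ∸ ∣ S ∣) (k ∸ ∣ R ∣)))
  -- Now `R` has k + 1 points: no k-set contains it, and both binomials have lower index 0.
  ... | no R≰k rewrite m≤n⇒m∸n≡0 (≰⇒> R≰k) | binom-zero (n ∸ ∣ S ∣) | binom-zero (suc (n ∸ ∣ S ∣)) = cong (_+ 1) (#-empty (trace? k S R)
          λ { F (c , e) → R≰k (≤-trans (≤-reflexive (cong ∣_∣ (sym e)))
                (≤-trans (∣p∩q∣≤∣p∣ F S) (≤-reflexive c))) })

-- Subsets and degrees

∣p∣≡∣p∩q∣+∣p∩∁q∣ : ∀ {n} (p q : Subset n) → ∣ p ∣ ≡ ∣ p ∩ q ∣ + ∣ p ∩ ∁ q ∣
∣p∣≡∣p∩q∣+∣p∩∁q∣ []          []          = refl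
∣p∣≡∣p∩q∣+∣p∩∁q∣ (true  ∷ p) (true  ∷ q) = cong suc (∣p∣≡∣p∩q∣+∣p∩∁q∣ p q)
∣p∣≡∣p∩q∣+∣p∩∁q∣ (true  ∷ p) (false ∷ q) =
  trans (cong suc (∣p∣≡∣p∩q∣+∣p∩∁q∣ p q)) (sym (+-suc ∣ p ∩ q ∣ _))
∣p∣≡∣p∩q∣+∣p∩∁q∣ (false ∷ p) (true  ∷ q) = ∣p∣≡∣p∩q∣+∣p∩∁q∣ p q
∣p∣≡∣p∩q∣+∣p∩∁q∣ (false ∷ p) (false ∷ q) = ∣p∣≡∣p∩q∣+∣p∩∁q∣ p q

∣p∪q∣+∣p∩q∣≡∣p∣+∣q∣ : ∀ {n} (p q : Subset n) → ∣ p ∪ q ∣ + ∣ p ∩ q ∣ ≡ ∣ p ∣ + ∣ q ∣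
∣p∪q∣+∣p∩q∣≡∣p∣+∣q∣ []          []          = refl
∣p∪q∣+∣p∩q∣≡∣p∣+∣q∣ (true  ∷ p) (true  ∷ q) = cong suc
  (trans (+-suc _ _) (trans (cong suc (∣p∪q∣+∣p∩q∣≡∣p∣+∣q∣ p q)) (sym (+-suc _ _))))
∣p∪q∣+∣p∩q∣≡∣p∣+∣q∣ (true  ∷ p) (false ∷ q) = cong suc (∣p∪q∣+∣p∩q∣≡∣p∣+∣q∣ p q)
∣p∪q∣+∣p∩q∣≡∣p∣+∣q∣ (false ∷ p) (true  ∷ q) =
  trans (cong suc (∣p∪q∣+∣p∩q∣≡∣p∣+∣q∣ p q)) (sym (+-suc _ _))
∣p∪q∣+∣p∩q∣≡∣p∣+∣q∣ (false ∷ p) (false ∷ q) = ∣p∪q∣+∣p∩q∣≡∣p∣+∣q∣ p q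

module _ {n : ℕ} where

  p⊆q⇒p∩q≡p : {p q : Subset n} → p ⊆ q → p ∩ q ≡ p
  p⊆q⇒p∩q≡p {p} {q} p⊆q = ⊆-antisym (p∩q⊆p p q) (λ x∈p → x∈p∩q⁺ (x∈p , p⊆q x∈p))

  p∩q≡p⇒p⊆q : {p q : Subset n} → p ∩ q ≡ p → p ⊆ q
  p∩q≡p⇒p⊆q {p} {q} eq x∈p = p∩q⊆q p q (subst (_ ∈_) (sym eq) x∈p)

  ∩-mono : {p q r s : Subset n} → p ⊆ r → q ⊆ s → p ∩ q ⊆ r ∩ s
  ∩-mono {p} {q} f g x∈ = let x∈p , x∈q = x∈p∩q⁻ p q x∈ in x∈p∩q⁺ (f x∈p , g x∈q)

  ∪-⊆ : {p q r : Subset n} → p ⊆ r → q ⊆ r → p ∪ q ⊆ r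
  ∪-⊆ {p} {q} f g x∈ = [ f , g ]′ (x∈p∪q⁻ p q x∈)

  ⁅⁆-⊆ : {x : Fin n} {p : Subset n} → x ∈ p → ⁅ x ⁆ ⊆ p
  ⁅⁆-⊆ {x} {p} x∈p y∈ = subst (_∈ p) (sym (x∈⁅y⁆⇒x≡y x y∈)) x∈p

  ∩∁⁻ : {x : Fin n} (p q : Subset n) → x ∈ p ∩ ∁ q → x ∈ p × x ∉ q
  ∩∁⁻ p q x∈ = let x∈p , x∈∁q = x∈p∩q⁻ p (∁ q) x∈ in x∈p , x∈∁p⇒x∉p x∈∁q

  ∩∁⁺ : {x : Fin n} {p q : Subset n} → x ∈ p → x ∉ q → x ∈ p ∩ ∁ q
  ∩∁⁺ x∈p x∉q = x∈p∩q⁺ (x∈p , x∉p⇒x∈∁p x∉q)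

  card-nonempty : (p : Subset n) → 0 < ∣ p ∣ → Nonempty p
  card-nonempty p 0<p with nonempty? p
  ... | yes ne = ne
  ... | no  em = ⊥-elim (<⇒≢ 0<p (sym (trans (cong ∣_∣ (Empty-unique em)) (∣⊥∣≡0 n))))

  ⊈-witness : (p q : Subset n) → p ⊈ q → ∃ λ x → x ∈ p × x ∉ q
  ⊈-witness p q p⊈q with nonempty? (p ∩ ∁ q)
  ... | yes (x , x∈) = x , ∩∁⁻ p q x∈
  ... | no  em       = ⊥-elim (p⊈q λ {x} x∈p → case x x∈p (x ∈? q))
    where
    case : ∀ x → x ∈ p → Dec (x ∈ q) → x ∈ q
    case x x∈p (yes x∈q) = x∈q
    case x x∈p (no  x∉q) = ⊥-elim (em (x , ∩∁⁺ x∈p x∉q))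

  ⊆-card-≡ : {p q : Subset n} → p ⊆ q → ∣ q ∣ ≤ ∣ p ∣ → p ≡ q
  ⊆-card-≡ {p} {q} p⊆q q≤p with q ⊆? p
  ... | yes q⊆p = ⊆-antisym p⊆q q⊆p
  ... | no  q⊈p = ⊥-elim (<⇒≱ (p⊂q⇒∣p∣<∣q∣ (p⊆q , ⊈-witness q p q⊈p)) q≤p)

  ⊈-card : {p q : Subset n} → p ⊈ q → ∣ p ∩ q ∣ < ∣ p ∣
  ⊈-card {p} {q} p⊈q = p⊂q⇒∣p∣<∣q∣ (p∩q⊆p p q ,
    (let x , x∈p , x∉q = ⊈-witness p q p⊈q in x , x∈p , λ x∈ → x∉q (p∩q⊆q p q x∈)))

  card-⊆ : {p q : Subset n} → ∣ p ∣ ≤ ∣ p ∩ q ∣ → p ⊆ q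
  card-⊆ {p} {q} le with p ⊆? q
  ... | yes p⊆q = p⊆q
  ... | no  p⊈q = ⊥-elim (<⇒≱ (⊈-card p⊈q) le)

  ∣p∪q∣-disjoint : (p q : Subset n) → (∀ {x} → x ∈ p → x ∉ q) → ∣ p ∪ q ∣ ≡ ∣ p ∣ + ∣ q ∣
  ∣p∪q∣-disjoint p q disj = trans (sym (trans (cong (∣ p ∪ q ∣ +_) empty) (+-identityʳ _)))
    (∣p∪q∣+∣p∩q∣≡∣p∣+∣q∣ p q)
    where
    empty : ∣ p ∩ q ∣ ≡ 0
    empty = trans (cong ∣_∣ (Empty-unique λ { (x , x∈) →
      let x∈p , x∈q = x∈p∩q⁻ p q x∈ in disj x∈p x∈q })) (∣⊥∣≡0 n)

  ∣insert∣ : (p : Subset n) (x : Fin n) → x ∉ p → ∣ p ∪ ⁅ x ⁆ ∣ ≡ suc ∣ p ∣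
  ∣insert∣ p x x∉p = trans
    (∣p∪q∣-disjoint p ⁅ x ⁆ (λ y∈p y∈ → x∉p (subst (_∈ p) (x∈⁅y⁆⇒x≡y x y∈) y∈p)))
    (trans (cong (∣ p ∣ +_) (∣⁅x⁆∣≡1 x)) (+-comm ∣ p ∣ 1))

  ∣remove∣ : (p : Subset n) (x : Fin n) → x ∈ p → suc ∣ p ∩ ∁ ⁅ x ⁆ ∣ ≡ ∣ p ∣
  ∣remove∣ p x x∈p = sym (trans (∣p∣≡∣p∩q∣+∣p∩∁q∣ p ⁅ x ⁆) (cong (_+ ∣ p ∩ ∁ ⁅ x ⁆ ∣)
    (trans (cong ∣_∣ (trans (∩-comm p ⁅ x ⁆) (p⊆q⇒p∩q≡p (⁅⁆-⊆ x∈p)))) (∣⁅x⁆∣≡1 x))))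

sub-of-size : ∀ {n} (p : Subset n) m → m ≤ ∣ p ∣ → ∃ λ q → q ⊆ p × ∣ q ∣ ≡ m
sub-of-size {n} p           zero    _  = ⊥ , ⊥⊆ , ∣⊥∣≡0 n
sub-of-size     (true  ∷ p) (suc m) le = let q , q⊆p , eq = sub-of-size p m (s≤s⁻¹ le) in
  true ∷ q , in⊆in q⊆p , cong suc eq
sub-of-size     (false ∷ p) (suc m) le = let q , q⊆p , eq = sub-of-size p (suc m) le in
  false ∷ q , out⊆ q⊆p , eq

super-of-size : ∀ {n} (p : Subset n) m → ∣ p ∣ ≤ m → m ≤ n → ∃ λ q → p ⊆ q × ∣ q ∣ ≡ m
super-of-size {n} p m p≤m m≤n =
  let r , r⊆∁p , eq = sub-of-size (∁ p) (m ∸ ∣ p ∣)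
        (≤-trans (∸-monoˡ-≤ ∣ p ∣ m≤n) (≤-reflexive (sym (∣∁p∣≡n∸∣p∣ p))))
  in p ∪ r , p⊆p∪q r ,
     trans (∣p∪q∣-disjoint p r (λ x∈p x∈r → x∈∁p⇒x∉p (r⊆∁p x∈r) x∈p))
       (trans (cong (∣ p ∣ +_) eq) (m+[n∸m]≡n p≤m))

-- If `F` avoided `D`, then F ∩ G would lie in G minus D, which has fewer than t points.
meets : ∀ {n} t (F G D : Subset n) → D ⊆ G → ∣ G ∣ < t + ∣ D ∣ → t ≤ ∣ F ∩ G ∣ →
        ∃ λ x → x ∈ D × x ∈ F
meets t F G D D⊆G G<t+D t≤F∩G with nonempty? (D ∩ F)
... | yes (x , x∈) = x , x∈p∩q⁻ D F x∈
... | no  em = ⊥-elim (<⇒≱ G<t+D (begin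
  t + ∣ D ∣                     ≤⟨ +-monoˡ-≤ ∣ D ∣ t≤F∩G ⟩
  ∣ F ∩ G ∣ + ∣ D ∣             ≤⟨ +-mono-≤ (p⊆q⇒∣p∣≤∣q∣ F∩G⊆) (p⊆q⇒∣p∣≤∣q∣ (λ x∈D → x∈p∩q⁺ (D⊆G x∈D , x∈D))) ⟩
  ∣ G ∩ ∁ D ∣ + ∣ G ∩ D ∣       ≡⟨ +-comm ∣ G ∩ ∁ D ∣ _ ⟩
  ∣ G ∩ D ∣ + ∣ G ∩ ∁ D ∣       ≡⟨ sym (∣p∣≡∣p∩q∣+∣p∩∁q∣ G D) ⟩
  ∣ G ∣                         ∎))
  where
  open ≤-Reasoning
  F∩G⊆ : F ∩ G ⊆ G ∩ ∁ D
  F∩G⊆ x∈ = let x∈F , x∈G = x∈p∩q⁻ F G x∈ in ∩∁⁺ x∈G λ x∈D → em (_ , x∈p∩q⁺ (x∈D , x∈F))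

module _ {n : ℕ} where

  through : {P : Subset n → Set} → Decidable P → (x : Fin n) → Decidable (λ F → P F × x ∈ F)
  through P? x F = P? F ×-dec (x ∈? F)

  avoiding : {P : Subset n → Set} → Decidable P → (x : Fin n) → Decidable (λ F → P F × x ∉ F)
  avoiding P? x F = P? F ×-dec ¬? (x ∈? F)

  over : {P : Subset n → Set} → Decidable P → (S : Subset n) → Decidable (λ F → P F × S ⊆ F)
  over P? S F = P? F ×-dec (S ⊆? F)

  degree : {P : Subset n → Set} → Decidable P → Subset n → ℕ
  degree P? S = # (over P? S)

  degree-mono : {P Q : Subset n → Set} (P? : Decidable P) (Q? : Decidable Q) (S : Subset n) →
                (∀ F → P F → Q F) → degree P? S ≤ degree Q? S
  degree-mono P? Q? S h = #-mono (over P? S) (over Q? S) λ { F (p , S⊆F) → h F p , S⊆F }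

  #-case : {P Q : Subset n → Set} (P? : Decidable P) (Q? : Decidable Q) →
           # P? ≤ # (λ F → P? F ×-dec Q? F) + # (λ F → P? F ×-dec ¬? (Q? F))
  #-case {P} {Q} P? Q? = #-split P? _ _ λ F p → case p (Q? F)
    where
    case : ∀ {F} → P F → Dec (Q F) → (P F × Q F) ⊎ (P F × ¬ Q F)
    case p (yes q) = inj₁ (p , q)
    case p (no ¬q) = inj₂ (p , ¬q)

  far : {P : Subset n → Set} → Decidable P → ∀ t G → Decidable (λ F → P F × ∣ F ∩ G ∣ < t)
  far P? t G F = P? F ×-dec (∣ F ∩ G ∣ <? t)

  near : {P : Subset n → Set} → Decidable P → ∀ t G → Decidable (λ F → P F × t ≤ ∣ F ∩ G ∣)
  near P? t G F = P? F ×-dec (t ≤? ∣ F ∩ G ∣)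

  far-or-near : {P : Subset n → Set} → ∀ t G F → P F → (P F × ∣ F ∩ G ∣ < t) ⊎ (P F × t ≤ ∣ F ∩ G ∣)
  far-or-near t G F p with ∣ F ∩ G ∣ <? t
  ... | yes lt = inj₁ (p , lt)
  ... | no  ge = inj₂ (p , ≮⇒≥ ge)

  #-near : {P : Subset n → Set} (P? : Decidable P) → ∀ t G → # P? ≤ # (far P? t G) + # (near P? t G)
  #-near {P} P? t G = #-split P? (far P? t G) (near P? t G) (far-or-near {P} t G)

  degree-near : {P : Subset n → Set} (P? : Decidable P) → ∀ t G S →
                degree P? S ≤ # (far P? t G) + degree (near P? t G) S
  degree-near {P} P? t G S = #-split (over P? S) (far P? t G) (over (near P? t G) S)
    λ F (p , S⊆F) → lift S⊆F (far-or-near {P} t G F p)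
    where
    lift : ∀ {A B F} → S ⊆ F → A ⊎ B → A ⊎ (B × S ⊆ F)
    lift S⊆F (inj₁ f) = inj₁ f
    lift S⊆F (inj₂ c) = inj₂ (c , S⊆F)

  #-cover : ∀ {P : Subset n → Set} {R : Fin n → Subset n → Set}
            (P? : Decidable P) (R? : ∀ x → Decidable (R x)) D b →
            (∀ x → x ∈ D → # (λ F → P? F ×-dec R? x F) ≤ b) →
            (∀ F → P F → ∃ λ x → x ∈ D × R x F) → # P? ≤ ∣ D ∣ * b
  #-cover {R = R} P? R? D b = go ∣ D ∣ P? D refl
    where
    go : ∀ m {P : Subset n → Set} (P? : Decidable P) D → ∣ D ∣ ≡ m →
         (∀ x → x ∈ D → # (λ F → P? F ×-dec R? x F) ≤ b) →
         (∀ F → P F → ∃ λ x → x ∈ D × R x F) → # P? ≤ m * b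
    go zero    P? D eq bound hit = ≤-reflexive (#-empty P? λ F p →
      let x , x∈D , _ = hit F p in
      1+n≰n {0} (≤-trans (≤-trans (≤-reflexive (sym (∣⁅x⁆∣≡1 x))) (p⊆q⇒∣p∣≤∣q∣ (⁅⁆-⊆ x∈D))) (≤-reflexive eq)))
    go (suc m) P? D eq bound hit with card-nonempty D (≤-trans (s≤s z≤n) (≤-reflexive (sym eq)))
    ... | x , x∈D = ≤-trans (#-case P? (R? x)) (+-mono-≤ (bound x x∈D)
      (go m rest? (D ∩ ∁ ⁅ x ⁆) (suc-injective (trans (∣remove∣ D x x∈D) eq))
        (λ y y∈ → ≤-trans (#-mono (λ F → rest? F ×-dec R? y F) (λ F → P? F ×-dec R? y F)
            λ { F ((p , _) , r) → p , r })
          (bound y (proj₁ (∩∁⁻ D ⁅ x ⁆ y∈))))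
        λ { F (p , ¬r) → let y , y∈D , r = hit F p in
            y , ∩∁⁺ y∈D (λ y∈ → ¬r (subst (λ z → R z F) (x∈⁅y⁆⇒x≡y x y∈) r)) , r }))
      where
      rest? : Decidable _
      rest? F = P? F ×-dec ¬? (R? x F)

  degree-transversal : ∀ {P : Subset n → Set} (P? : Decidable P) S D b →
    (∀ x → x ∈ D → degree P? (S ∪ ⁅ x ⁆) ≤ b) →
    (∀ F → P F → S ⊆ F → ∃ λ x → x ∈ D × x ∈ F) → degree P? S ≤ ∣ D ∣ * b
  degree-transversal P? S D b bound hit = #-cover (over P? S) (λ x F → x ∈? F) D b
    (λ x x∈D → ≤-trans (#-mono (through (over P? S) x) (over P? (S ∪ ⁅ x ⁆))
      λ { F ((p , S⊆F) , x∈F) → p , ∪-⊆ S⊆F (⁅⁆-⊆ x∈F) }) (bound x x∈D))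
    λ { F (p , S⊆F) → hit F p S⊆F }

  -- The basic branching step: G minus S has at least d + 1 points, and members near `G` that
  -- contain `S` hit any d + 1 of them. `G` need not be a member, so that a heavy set can take its
  -- place.
  degree-branch : ∀ {P : Subset n → Set} (P? : Decidable P) t d s S G b →
    ∣ G ∣ ≡ t + d → ∣ S ∩ G ∣ < t → # (far P? t G) ≤ s →
    (∀ x → x ∈ G → x ∉ S → degree P? (S ∪ ⁅ x ⁆) ≤ b) → degree P? S ≤ s + suc d * b
  degree-branch {P} P? t d s S G b G≡ S∩G<t bad≤s bound =
    let D , D⊆ , D≡ = sub-of-size (G ∩ ∁ S) (suc d) room
        in-D : ∀ {x} → x ∈ D → x ∈ G × x ∉ S
        in-D x∈D = ∩∁⁻ G S (D⊆ x∈D)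
    in ≤-trans (degree-near P? t G S) (+-mono-≤ bad≤s
         (≤-trans (degree-transversal good? S D b
           (λ x x∈D → ≤-trans (degree-mono good? P? (S ∪ ⁅ x ⁆) (λ _ → proj₁))
             (bound x (proj₁ (in-D x∈D)) (proj₂ (in-D x∈D))))
           λ { F (_ , t≤) _ → meets t F G D (proj₁ ∘ in-D)
                 (≤-reflexive (trans (cong suc G≡) (trans (sym (+-suc t d)) (cong (t +_) (sym D≡))))) t≤ })
         (≤-reflexive (cong (_* b) D≡))))
    where
    good? = near P? t G
    room : suc d ≤ ∣ G ∩ ∁ S ∣
    room = +-cancelˡ-≤ t _ _ (begin
      t + suc d                      ≡⟨ trans (+-suc t d) (cong suc (sym G≡)) ⟩
      suc ∣ G ∣                      ≡⟨ cong suc (∣p∣≡∣p∩q∣+∣p∩∁q∣ G S) ⟩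
      suc ∣ G ∩ S ∣ + ∣ G ∩ ∁ S ∣    ≡⟨ cong (λ u → suc ∣ u ∣ + ∣ G ∩ ∁ S ∣) (∩-comm G S) ⟩
      suc ∣ S ∩ G ∣ + ∣ G ∩ ∁ S ∣    ≤⟨ +-monoˡ-≤ _ S∩G<t ⟩
      t + ∣ G ∩ ∁ S ∣                ∎)
      where open ≤-Reasoning

  -- A union bound over the j-subsets of `S` that never lists them: splitting by whether a point of
  -- `S` lies in the member reproduces Pascal's rule.
  #-by-subsets : ∀ {P : Subset n → Set} (P? : Decidable P) S j b →
    (∀ R → R ⊆ S → ∣ R ∣ ≡ j → degree P? R ≤ b) →
    (∀ F → P F → j ≤ ∣ F ∩ S ∣) → # P? ≤ binom ∣ S ∣ j * b
  #-by-subsets P? S j b = go ∣ S ∣ P? S j refl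
    where
    go : ∀ m {P : Subset n → Set} (P? : Decidable P) S j → ∣ S ∣ ≡ m →
         (∀ R → R ⊆ S → ∣ R ∣ ≡ j → degree P? R ≤ b) →
         (∀ F → P F → j ≤ ∣ F ∩ S ∣) → # P? ≤ binom m j * b
    go m P? S zero eq bound _ = begin
      # P?            ≤⟨ #-mono P? (over P? ⊥) (λ F p → p , ⊥⊆) ⟩
      degree P? ⊥     ≤⟨ bound ⊥ ⊥⊆ (∣⊥∣≡0 n) ⟩
      b               ≡⟨ sym (*-identityˡ b) ⟩
      1 * b           ≡⟨ cong (_* b) (sym (binom-zero m)) ⟩
      binom m 0 * b   ∎
      where open ≤-Reasoning
    go zero P? S (suc j) eq _ large = ≤-trans (≤-reflexive (#-empty P? λ F p →
      1+n≰n {0} (≤-trans (s≤s z≤n) (≤-trans (large F p) (≤-trans (∣p∩q∣≤∣q∣ F S) (≤-reflexive eq)))))) z≤n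
    go (suc m) P? S (suc j) eq bound large with card-nonempty S (≤-trans (s≤s z≤n) (≤-reflexive (sym eq)))
    ... | x , x∈S = begin
      # P?                                        ≤⟨ #-case P? (x ∈?_) ⟩
      # (through P? x) + # (avoiding P? x)        ≤⟨ +-mono-≤
        (go m (through P? x) S′ j S′≡ boundIn largeIn) (go m (avoiding P? x) S′ (suc j) S′≡ boundOut largeOut) ⟩
      binom m j * b + binom m (suc j) * b         ≡⟨ sym (*-distribʳ-+ b (binom m j) (binom m (suc j))) ⟩
      (binom m j + binom m (suc j)) * b           ≡⟨ cong (_* b) (sym (binom-suc m j)) ⟩
      binom (suc m) (suc j) * b                   ∎
      where
      open ≤-Reasoning
      S′ = S ∩ ∁ ⁅ x ⁆
      S′≡ : ∣ S′ ∣ ≡ m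
      S′≡ = suc-injective (trans (∣remove∣ S x x∈S) eq)
      S′⊆S : S′ ⊆ S
      S′⊆S = p∩q⊆p S (∁ ⁅ x ⁆)
      boundIn : ∀ R → R ⊆ S′ → ∣ R ∣ ≡ j → degree (through P? x) R ≤ b
      boundIn R R⊆S′ R≡ = ≤-trans
        (#-mono (over (through P? x) R) (over P? (R ∪ ⁅ x ⁆))
          λ { F ((p , x∈F) , R⊆F) → p , ∪-⊆ R⊆F (⁅⁆-⊆ x∈F) })
        (bound (R ∪ ⁅ x ⁆) (∪-⊆ (S′⊆S ∘ R⊆S′) (⁅⁆-⊆ x∈S))
          (trans (∣insert∣ R x λ x∈R → proj₂ (∩∁⁻ S ⁅ x ⁆ (R⊆S′ x∈R)) (x∈⁅x⁆ x)) (cong suc R≡)))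
      boundOut : ∀ R → R ⊆ S′ → ∣ R ∣ ≡ suc j → degree (avoiding P? x) R ≤ b
      boundOut R R⊆S′ R≡ = ≤-trans (degree-mono (avoiding P? x) P? R (λ _ → proj₁)) (bound R (S′⊆S ∘ R⊆S′) R≡)
      largeIn : ∀ F → _ × x ∈ F → j ≤ ∣ F ∩ S′ ∣
      largeIn F (p , x∈F) = s≤s⁻¹ (begin
        suc j                             ≤⟨ large F p ⟩
        ∣ F ∩ S ∣                         ≡⟨ sym (∣remove∣ (F ∩ S) x (x∈p∩q⁺ (x∈F , x∈S))) ⟩
        suc ∣ (F ∩ S) ∩ ∁ ⁅ x ⁆ ∣         ≡⟨ cong (suc ∘ ∣_∣) (∩-assoc F S (∁ ⁅ x ⁆)) ⟩
        suc ∣ F ∩ S′ ∣                    ∎)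
      largeOut : ∀ F → _ × x ∉ F → suc j ≤ ∣ F ∩ S′ ∣
      largeOut F (p , x∉F) = ≤-trans (large F p) (p⊆q⇒∣p∣≤∣q∣ λ y∈ →
        let y∈F , y∈S = x∈p∩q⁻ F S y∈ in
        x∈p∩q⁺ (y∈F , ∩∁⁺ y∈S λ y∈⁅x⁆ → x∉F (subst (_∈ F) (x∈⁅y⁆⇒x≡y x y∈⁅x⁆) y∈F)))

  degree-≤-binom : ∀ {P : Subset n → Set} (P? : Decidable P) k S → (∀ F → P F → ∣ F ∣ ≡ k) →
                   ∣ S ∣ ≤ k → degree P? S ≤ binom (n ∸ ∣ S ∣) (k ∸ ∣ S ∣)
  degree-≤-binom P? k S uniform S≤k = ≤-trans
    (#-mono (over P? S) (trace? k S S)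
      λ { F (p , S⊆F) → uniform F p , trans (∩-comm F S) (p⊆q⇒p∩q≡p S⊆F) })
    (≤-reflexive (#-trace k S S (∩-idem S) S≤k))

-- Heavy sets and almost covers

module _ {n : ℕ} where

  ∣p∣+∣q∣≤∣r∣+∣p∩q∣ : {p q r : Subset n} → p ⊆ r → q ⊆ r → ∣ p ∣ + ∣ q ∣ ≤ ∣ r ∣ + ∣ p ∩ q ∣
  ∣p∣+∣q∣≤∣r∣+∣p∩q∣ {p} {q} f g = ≤-trans (≤-reflexive (sym (∣p∪q∣+∣p∩q∣≡∣p∣+∣q∣ p q)))
    (+-monoˡ-≤ ∣ p ∩ q ∣ (p⊆q⇒∣p∣≤∣q∣ (∪-⊆ f g)))

  -- B ∩ R has at most t - 1 points, so reaching t with one extra point forces that point into `B`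
  -- and leaves exactly one point of `R` missing.
  pinned : ∀ {t} (R B : Subset n) p → ∣ R ∣ ≡ t → R ⊈ B → t ≤ ∣ B ∩ (R ∪ ⁅ p ⁆) ∣ →
           p ∈ B × suc ∣ B ∩ R ∣ ≡ t
  pinned {t} R B p R≡ R⊈B le = p∈B (p ∈? B) , ≤-antisym B∩R<t t≤
    where
    B∩R<t : ∣ B ∩ R ∣ < t
    B∩R<t = subst₂ _<_ (cong ∣_∣ (∩-comm R B)) R≡ (⊈-card R⊈B)
    p∈B : Dec (p ∈ B) → p ∈ B
    p∈B (yes p∈) = p∈
    p∈B (no  p∉) = ⊥-elim (<⇒≱ B∩R<t (≤-trans le (p⊆q⇒∣p∣≤∣q∣ λ {x} x∈ →
      let x∈B , x∈∪ = x∈p∩q⁻ B (R ∪ ⁅ p ⁆) x∈ in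
      [ (λ x∈R → x∈p∩q⁺ (x∈B , x∈R)) ,
        (λ x∈p → ⊥-elim (p∉ (subst (_∈ B) (x∈⁅y⁆⇒x≡y p x∈p) x∈B))) ]′ (x∈p∪q⁻ R ⁅ p ⁆ x∈∪))))
    t≤ : t ≤ suc ∣ B ∩ R ∣
    t≤ = begin
      t                                       ≤⟨ le ⟩
      ∣ B ∩ (R ∪ ⁅ p ⁆) ∣                     ≤⟨ p⊆q⇒∣p∣≤∣q∣ sub ⟩
      ∣ (B ∩ R) ∪ ⁅ p ⁆ ∣                     ≤⟨ m≤m+n _ _ ⟩
      ∣ (B ∩ R) ∪ ⁅ p ⁆ ∣ + ∣ (B ∩ R) ∩ ⁅ p ⁆ ∣ ≡⟨ ∣p∪q∣+∣p∩q∣≡∣p∣+∣q∣ (B ∩ R) ⁅ p ⁆ ⟩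
      ∣ B ∩ R ∣ + ∣ ⁅ p ⁆ ∣                   ≡⟨ trans (cong (∣ B ∩ R ∣ +_) (∣⁅x⁆∣≡1 p)) (+-comm _ 1) ⟩
      suc ∣ B ∩ R ∣                           ∎
      where
      open ≤-Reasoning
      sub : B ∩ (R ∪ ⁅ p ⁆) ⊆ (B ∩ R) ∪ ⁅ p ⁆
      sub x∈ = let x∈B , x∈∪ = x∈p∩q⁻ B (R ∪ ⁅ p ⁆) x∈ in
        x∈p∪q⁺ ([ (λ x∈R → inj₁ (x∈p∩q⁺ (x∈B , x∈R))) , inj₂ ]′ (x∈p∪q⁻ R ⁅ p ⁆ x∈∪))

  ∣insert²∣ : (p : Subset n) (x y : Fin n) → x ∉ p → y ∉ p → x ≢ y → ∣ (p ∪ ⁅ x ⁆) ∪ ⁅ y ⁆ ∣ ≡ 2 + ∣ p ∣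
  ∣insert²∣ p x y x∉p y∉p x≢y = trans (∣insert∣ (p ∪ ⁅ x ⁆) y λ y∈ →
    [ y∉p , (λ y∈⁅x⁆ → x≢y (sym (x∈⁅y⁆⇒x≡y x y∈⁅x⁆))) ]′ (x∈p∪q⁻ p ⁅ x ⁆ y∈))
    (cong suc (∣insert∣ p x x∉p))

module Structure {n t e s : ℕ} {P : Subset n → Set} (P? : Decidable P)
  (k≤n : t + (2 + e) ≤ n)
  (uniform : ∀ F → P F → ∣ F ∣ ≡ t + (2 + e))
  (almost : ∀ F → P F → # (far P? t F) ≤ s)
  (crossing : ¬ (∀ F F′ → P F → P F′ → t ≤ ∣ F ∩ F′ ∣)) where

  N : ℕ → ℕ
  N m = binom (n ∸ m) (t + (2 + e) ∸ m)

  degree-≤ : ∀ S m → ∣ S ∣ ≡ m → m ≤ t + (2 + e) → degree P? S ≤ N m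
  degree-≤ S m refl = degree-≤-binom P? (t + (2 + e)) S uniform

  light : ℕ
  light = s + (3 + e) * N (2 + t)

  2+t≤k : 2 + t ≤ t + (2 + e)
  2+t≤k = ≤-trans (≤-reflexive (+-comm 2 t)) (+-monoʳ-≤ t (m≤m+n 2 e))

  Heavy : Subset n → Set
  Heavy L = ∣ L ∣ ≡ suc t × light < degree P? L

  heavy? : Decidable Heavy
  heavy? L = (∣ L ∣ ≟ suc t) ×-dec (light <? degree P? L)

  light-degree : ∀ L → ∣ L ∣ ≡ suc t → ¬ Heavy L → degree P? L ≤ light
  light-degree L L≡ ¬heavy = ≮⇒≥ λ lt → ¬heavy (L≡ , lt)

  insert-degree : ∀ L → ∣ L ∣ ≡ suc t → ∀ x → x ∉ L → degree P? (L ∪ ⁅ x ⁆) ≤ N (2 + t)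
  insert-degree L L≡ x x∉L = degree-≤ (L ∪ ⁅ x ⁆) (2 + t) (trans (∣insert∣ L x x∉L) (cong suc L≡)) 2+t≤k

  heavy-cover : ∀ L → Heavy L → ∀ F → P F → t ≤ ∣ F ∩ L ∣
  heavy-cover L (L≡ , heavy) F p = ≮⇒≥ λ lt → <⇒≱ heavy
    (degree-branch P? t (2 + e) s L F (N (2 + t)) (uniform F p)
      (subst (_< t) (cong ∣_∣ (∩-comm F L)) lt) (almost F p) (λ x _ → insert-degree L L≡ x))

  -- A heavy set in the role of `G`: it has t + 1 points and, by `heavy-cover`, no far members.
  -- Branching with d = 1 and s = 0 thus gives degree at most 2 `N (2 + t)`, below the threshold
  -- `light`.
  heavy-meet : ∀ L L′ → Heavy L → Heavy L′ → t ≤ ∣ L ∩ L′ ∣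
  heavy-meet L L′ (L≡ , heavy) heavy′ = ≮⇒≥ λ lt → <⇒≱ heavy (≤-trans
    (degree-branch P? t 1 0 L L′ (N (2 + t)) (trans (proj₁ heavy′) (+-comm 1 t)) lt
      (≤-reflexive (#-empty (far P? t L′) λ { F (p , bad) → <⇒≱ bad (heavy-cover L′ heavy′ F p) }))
      (λ x _ → insert-degree L L≡ x))
    (≤-trans (*-monoˡ-≤ (N (2 + t)) (s≤s (s≤s (z≤n {suc e})))) (m≤n+m ((3 + e) * N (2 + t)) s)))

  -- If all members contained `R`, any two would share its t or more points, against `crossing`.
  escape : ∀ R → t ≤ ∣ R ∣ → ∃ λ G → P G × R ⊈ G
  escape R t≤ with anySubset? (λ G → P? G ×-dec ¬? (R ⊆? G))
  ... | yes found = found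
  ... | no  none  = ⊥-elim (crossing λ F F′ p p′ → ≤-trans t≤
    (p⊆q⇒∣p∣≤∣q∣ λ x∈R → x∈p∩q⁺ (inside F p x∈R , inside F′ p′ x∈R)))
    where
    inside : ∀ F → P F → R ⊆ F
    inside F p with R ⊆? F
    ... | yes R⊆F = R⊆F
    ... | no  R⊈F = ⊥-elim (none (F , p , R⊈F))

  Concentrated : Set
  Concentrated = ∃ λ R → ∃ λ W → R ⊆ W × ∣ R ∣ ≡ t × ∣ W ∣ ≡ suc (t + (2 + e)) ×
    (∀ F → P F → R ⊈ F → F ⊆ W) × (∃ λ G → P G × R ⊈ G)

  module Sunflower (L₁ L₂ : Subset n) (heavy₁ : Heavy L₁) (heavy₂ : Heavy L₂) (L₁≢L₂ : L₁ ≢ L₂) where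

    R : Subset n
    R = L₁ ∩ L₂

    L₁⊈L₂ : L₁ ⊈ L₂
    L₁⊈L₂ L₁⊆L₂ = L₁≢L₂ (⊆-card-≡ L₁⊆L₂ (≤-reflexive (trans (proj₁ heavy₂) (sym (proj₁ heavy₁)))))

    L₂⊈L₁ : L₂ ⊈ L₁
    L₂⊈L₁ L₂⊆L₁ = L₁≢L₂ (sym (⊆-card-≡ L₂⊆L₁ (≤-reflexive (trans (proj₁ heavy₁) (sym (proj₁ heavy₂))))))

    ∣R∣≡t : ∣ R ∣ ≡ t
    ∣R∣≡t = ≤-antisym (s≤s⁻¹ (subst (∣ R ∣ <_) (proj₁ heavy₁) (⊈-card L₁⊈L₂)))
                      (heavy-meet L₁ L₂ heavy₁ heavy₂)

    petal₁ : ∃ λ x → x ∈ L₁ × x ∉ L₂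
    petal₁ = ⊈-witness L₁ L₂ L₁⊈L₂

    petal₂ : ∃ λ x → x ∈ L₂ × x ∉ L₁
    petal₂ = ⊈-witness L₂ L₁ L₂⊈L₁

    p₁ = proj₁ petal₁
    p₂ = proj₁ petal₂

    p₁∉R : p₁ ∉ R
    p₁∉R = proj₂ (proj₂ petal₁) ∘ p∩q⊆q L₁ L₂

    p₂∉R : p₂ ∉ R
    p₂∉R = proj₂ (proj₂ petal₂) ∘ p∩q⊆p L₁ L₂

    p₁≢p₂ : p₁ ≢ p₂
    p₁≢p₂ eq = proj₂ (proj₂ petal₂) (subst (_∈ L₁) eq (proj₁ (proj₂ petal₁)))

    ∣R∪p∣ : ∀ p → p ∉ R → ∣ R ∪ ⁅ p ⁆ ∣ ≡ suc t
    ∣R∪p∣ p p∉R = trans (∣insert∣ R p p∉R) (cong suc ∣R∣≡t)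

    L₁≡ : R ∪ ⁅ p₁ ⁆ ≡ L₁
    L₁≡ = ⊆-card-≡ (∪-⊆ (p∩q⊆p L₁ L₂) (⁅⁆-⊆ (proj₁ (proj₂ petal₁))))
      (≤-reflexive (trans (proj₁ heavy₁) (sym (∣R∪p∣ p₁ p₁∉R))))

    L₂≡ : R ∪ ⁅ p₂ ⁆ ≡ L₂
    L₂≡ = ⊆-card-≡ (∪-⊆ (p∩q⊆q L₁ L₂) (⁅⁆-⊆ (proj₁ (proj₂ petal₂))))
      (≤-reflexive (trans (proj₁ heavy₂) (sym (∣R∪p∣ p₂ p₂∉R))))

    pinned₁ : ∀ B → R ⊈ B → t ≤ ∣ B ∩ L₁ ∣ → p₁ ∈ B × suc ∣ B ∩ R ∣ ≡ t
    pinned₁ B R⊈B le = pinned R B p₁ ∣R∣≡t R⊈B (subst (λ L → t ≤ ∣ B ∩ L ∣) (sym L₁≡) le)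

    pinned₂ : ∀ B → R ⊈ B → t ≤ ∣ B ∩ L₂ ∣ → p₂ ∈ B × suc ∣ B ∩ R ∣ ≡ t
    pinned₂ B R⊈B le = pinned R B p₂ ∣R∣≡t R⊈B (subst (λ L → t ≤ ∣ B ∩ L ∣) (sym L₂≡) le)

    X : Subset n
    X = (R ∪ ⁅ p₁ ⁆) ∪ ⁅ p₂ ⁆

    ∣X∣ : ∣ X ∣ ≡ 2 + t
    ∣X∣ = trans (∣insert²∣ R p₁ p₂ p₁∉R p₂∉R p₁≢p₂) (cong (2 +_) ∣R∣≡t)

    -- If `B` lacks just one point of `R`, these are the t + 1 points forced by both petals. A
    -- member that misses x ∈ R contains the frame of the complement of x, which is R minus x
    -- together with `p₁` and `p₂`.
    frame : Subset n → Subset n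
    frame B = ((B ∩ R) ∪ ⁅ p₁ ⁆) ∪ ⁅ p₂ ⁆

    frame-card : ∀ B → suc ∣ B ∩ R ∣ ≡ t → ∣ frame B ∣ ≡ suc t
    frame-card B eq = trans (∣insert²∣ (B ∩ R) p₁ p₂ (p₁∉R ∘ p∩q⊆q B R) (p₂∉R ∘ p∩q⊆q B R) p₁≢p₂) (cong suc eq)

    frame-⊆ : ∀ B → p₁ ∈ B → p₂ ∈ B → frame B ⊆ B
    frame-⊆ B p₁∈ p₂∈ = ∪-⊆ (∪-⊆ (p∩q⊆p B R) (⁅⁆-⊆ p₁∈)) (⁅⁆-⊆ p₂∈)

    frame-⊆-X : ∀ B → frame B ⊆ X
    frame-⊆-X B = ∪-⊆ (∪-⊆ (p⊆p∪q ⁅ p₂ ⁆ ∘ p⊆p∪q ⁅ p₁ ⁆ ∘ p∩q⊆q B R)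
      (p⊆p∪q ⁅ p₂ ⁆ ∘ q⊆p∪q R ⁅ p₁ ⁆)) (q⊆p∪q (R ∪ ⁅ p₁ ⁆) ⁅ p₂ ⁆)

    -- Otherwise every member meets the (t+2)-set X in at least t+1 points, so
    -- that any two members meet in at least t.
    heavy-over-R : ∀ L → Heavy L → R ⊆ L
    heavy-over-R L heavy with R ⊆? L
    ... | yes R⊆L = R⊆L
    ... | no  R⊈L = ⊥-elim (crossing λ F F′ p p′ → +-cancelˡ-≤ (2 + t) _ _ (begin
      2 + t + t                                ≡⟨ sym (cong suc (+-suc t t)) ⟩
      suc t + suc t                            ≤⟨ +-mono-≤ (large F p) (large F′ p′) ⟩
      ∣ F ∩ X ∣ + ∣ F′ ∩ X ∣                   ≤⟨ ∣p∣+∣q∣≤∣r∣+∣p∩q∣ (p∩q⊆q F X) (p∩q⊆q F′ X) ⟩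
      ∣ X ∣ + ∣ (F ∩ X) ∩ (F′ ∩ X) ∣           ≤⟨ +-mono-≤ (≤-reflexive ∣X∣)
                                                   (p⊆q⇒∣p∣≤∣q∣ (∩-mono (p∩q⊆p F X) (p∩q⊆p F′ X))) ⟩
      2 + t + ∣ F ∩ F′ ∣                       ∎))
      where
      open ≤-Reasoning
      at₁ = pinned₁ L R⊈L (heavy-meet L L₁ heavy heavy₁)
      at₂ = pinned₂ L R⊈L (heavy-meet L L₂ heavy heavy₂)
      L⊆X : L ⊆ X
      L⊆X = subst (_⊆ X) (⊆-card-≡ (frame-⊆ L (proj₁ at₁) (proj₁ at₂))
        (≤-reflexive (trans (proj₁ heavy) (sym (frame-card L (proj₂ at₁)))))) (frame-⊆-X L)
      R⊆X : R ⊆ X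
      R⊆X = p⊆p∪q ⁅ p₂ ⁆ ∘ p⊆p∪q ⁅ p₁ ⁆
      large : ∀ F → P F → suc t ≤ ∣ F ∩ X ∣
      large F p with R ⊆? F
      ... | no  R⊈F = ≤-trans (≤-reflexive (sym (frame-card F (proj₂ in₁))))
        (p⊆q⇒∣p∣≤∣q∣ λ x∈ → x∈p∩q⁺ (frame-⊆ F (proj₁ in₁) (proj₁ in₂) x∈ , frame-⊆-X F x∈))
        where
        in₁ = pinned₁ F R⊈F (heavy-cover L₁ heavy₁ F p)
        in₂ = pinned₂ F R⊈F (heavy-cover L₂ heavy₂ F p)
      -- With only t points in `X`, `F` would meet `X` in exactly `R`; as L ⊆ X, it would then meet
      -- `L` inside L ∩ R, which has t - 1 points.
      ... | yes R⊆F = ≰⇒> λ le → 1+n≰n (begin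
        suc ∣ L ∩ R ∣      ≡⟨ proj₂ at₁ ⟩
        t                  ≤⟨ heavy-cover L heavy F p ⟩
        ∣ F ∩ L ∣          ≤⟨ p⊆q⇒∣p∣≤∣q∣ (λ x∈ → let x∈F , x∈L = x∈p∩q⁻ F L x∈ in
                               x∈p∩q⁺ (x∈L , subst (_ ∈_) (sym (R≡ le)) (x∈p∩q⁺ (x∈F , L⊆X x∈L)))) ⟩
        ∣ L ∩ R ∣          ∎)
        where
        R≡ : ∣ F ∩ X ∣ ≤ t → R ≡ F ∩ X
        R≡ le = ⊆-card-≡ (λ x∈R → x∈p∩q⁺ (R⊆F x∈R , R⊆X x∈R)) (≤-trans le (≤-reflexive (sym ∣R∣≡t)))

    outside? : Decidable (λ F → P F × R ⊈ F)
    outside? F = P? F ×-dec ¬? (R ⊆? F)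

    outside-pinned : ∀ F → P F → R ⊈ F → p₁ ∈ F × p₂ ∈ F × suc ∣ F ∩ R ∣ ≡ t
    outside-pinned F p R⊈F =
      let in₁ , eq = pinned₁ F R⊈F (heavy-cover L₁ heavy₁ F p)
          in₂ , _  = pinned₂ F R⊈F (heavy-cover L₂ heavy₂ F p)
      in in₁ , in₂ , eq

    -- Sort these members by a missed x ∈ R. Each class lies over a (t + 1)-set avoiding x, which is
    -- light because `heavy-over-R` puts x into every heavy set.
    outside-few : # outside? ≤ t * light
    outside-few = ≤-trans (#-cover outside? (λ x F → ¬? (x ∈? F)) R light each miss)
      (≤-reflexive (cong (_* light) ∣R∣≡t))
      where
      miss : ∀ F → P F × R ⊈ F → ∃ λ x → x ∈ R × x ∉ F
      miss F (_ , R⊈F) = ⊈-witness R F R⊈F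
      each : ∀ x → x ∈ R → # (λ F → outside? F ×-dec ¬? (x ∈? F)) ≤ light
      each x x∈R = ≤-trans (#-mono _ (over P? (frame (∁ ⁅ x ⁆)))
          λ { F ((p , R⊈F) , x∉F) → p , frame-in F p R⊈F x∉F })
        (light-degree (frame (∁ ⁅ x ⁆)) (frame-card (∁ ⁅ x ⁆)
            (trans (cong suc (cong ∣_∣ (∩-comm (∁ ⁅ x ⁆) R))) (trans (∣remove∣ R x x∈R) ∣R∣≡t)))
          λ heavy → x∉frame (heavy-over-R _ heavy x∈R))
        where
        x∉frame : x ∉ frame (∁ ⁅ x ⁆)
        x∉frame x∈ = [ (λ x∈′ → [ (λ x∈″ → x∈∁p⇒x∉p (p∩q⊆p (∁ ⁅ x ⁆) R x∈″) (x∈⁅x⁆ x)) ,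
            (λ eq → p₁∉R (subst (_∈ R) (x∈⁅y⁆⇒x≡y p₁ eq) x∈R)) ]′ (x∈p∪q⁻ (∁ ⁅ x ⁆ ∩ R) ⁅ p₁ ⁆ x∈′)) ,
          (λ eq → p₂∉R (subst (_∈ R) (x∈⁅y⁆⇒x≡y p₂ eq) x∈R)) ]′ (x∈p∪q⁻ (∁ ⁅ x ⁆ ∩ R ∪ ⁅ p₁ ⁆) ⁅ p₂ ⁆ x∈)
        frame-in : ∀ F → P F → R ⊈ F → x ∉ F → frame (∁ ⁅ x ⁆) ⊆ F
        frame-in F p R⊈F x∉F = let p₁∈ , p₂∈ , eq = outside-pinned F p R⊈F in
          ∪-⊆ (∪-⊆ (rest eq) (⁅⁆-⊆ p₁∈)) (⁅⁆-⊆ p₂∈)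
          where
          rest : suc ∣ F ∩ R ∣ ≡ t → ∁ ⁅ x ⁆ ∩ R ⊆ F
          rest eq y∈ = p∩q⊆p F R (subst (_ ∈_) (sym same) (subst (_ ∈_) (∩-comm (∁ ⁅ x ⁆) R) y∈))
            where
            same : F ∩ R ≡ R ∩ ∁ ⁅ x ⁆
            same = ⊆-card-≡
              (λ z∈ → let z∈F , z∈R = x∈p∩q⁻ F R z∈ in
                ∩∁⁺ z∈R λ z∈x → x∉F (subst (_∈ F) (x∈⁅y⁆⇒x≡y x z∈x) z∈F))
              (≤-reflexive (suc-injective (trans (∣remove∣ R x x∈R) (trans ∣R∣≡t (sym eq)))))

    -- Members over `R` that are near `G` hit `D`, the d + 1 points of `G` outside `R`. One light
    -- direction in `D` lowers the count over `R` from d + 1 full stars to d, and this loss of about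
    -- N₁ exceeds all error terms.
    sunflower : Concentrated ⊎ # P? ≤ s + (light + (2 + e) * N (1 + t)) + t * light
    sunflower with escape R (≤-reflexive (sym ∣R∣≡t))
    ... | G , pG , R⊈G with any? (λ x → (x ∈? (G ∩ ∁ R)) ×-dec ¬? (heavy? (R ∪ ⁅ x ⁆)))
    ...   | yes (x , x∈D , ¬heavy) = inj₂ (begin
      # P?                                       ≤⟨ #-case P? (R ⊆?_) ⟩
      degree P? R + # outside?                   ≤⟨ +-mono-≤ core outside-few ⟩
      s + (light + (2 + e) * N (1 + t)) + t * light ∎)
      where
      open ≤-Reasoning
      D = G ∩ ∁ R
      in-D : ∀ {y} → y ∈ D → y ∈ G × y ∉ R
      in-D = ∩∁⁻ G R
      eq : suc ∣ G ∩ R ∣ ≡ t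
      eq = proj₂ (proj₂ (outside-pinned G pG R⊈G))
      D≡ : ∣ D ∣ ≡ 3 + e
      D≡ = +-cancelˡ-≡ t _ _ (begin-equality
        t + ∣ D ∣                   ≡⟨ cong (_+ ∣ D ∣) (sym eq) ⟩
        suc (∣ G ∩ R ∣ + ∣ D ∣)     ≡⟨ cong suc (sym (∣p∣≡∣p∩q∣+∣p∩∁q∣ G R)) ⟩
        suc ∣ G ∣                   ≡⟨ cong suc (uniform G pG) ⟩
        suc (t + (2 + e))           ≡⟨ sym (+-suc t (2 + e)) ⟩
        t + (3 + e)                 ∎)
      good? = near P? t G
      hit : ∀ F → t ≤ ∣ F ∩ G ∣ → ∃ λ y → y ∈ D × y ∈ F
      hit F = meets t F G D (proj₁ ∘ in-D)
        (≤-reflexive (trans (cong suc (uniform G pG)) (trans (sym (+-suc t (2 + e))) (cong (t +_) (sym D≡)))))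
      branchAt : ∀ y → # (λ F → over good? R F ×-dec (y ∈? F)) ≤ degree P? (R ∪ ⁅ y ⁆)
      branchAt y = #-mono _ (over P? (R ∪ ⁅ y ⁆)) λ { F (((p , _) , R⊆F) , y∈F) → p , ∪-⊆ R⊆F (⁅⁆-⊆ y∈F) }
      rest? : Decidable (λ F → ((P F × t ≤ ∣ F ∩ G ∣) × R ⊆ F) × x ∉ F)
      rest? F = over good? R F ×-dec ¬? (x ∈? F)
      rest : # rest? ≤ (2 + e) * N (1 + t)
      rest = ≤-trans (#-cover rest? (λ y F → y ∈? F) (D ∩ ∁ ⁅ x ⁆) (N (1 + t))
          (λ y y∈ → ≤-trans (#-mono _ (λ F → over good? R F ×-dec (y ∈? F)) λ { F ((g , _) , y∈F) → g , y∈F })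
            (≤-trans (branchAt y) (degree-≤ (R ∪ ⁅ y ⁆) (1 + t)
              (∣R∪p∣ y (proj₂ (in-D (proj₁ (∩∁⁻ D ⁅ x ⁆ y∈))))) (≤-trans (n≤1+n _) 2+t≤k))))
          λ { F (((_ , t≤) , _) , x∉F) → let y , y∈D , y∈F = hit F t≤ in
              y , ∩∁⁺ y∈D (λ y∈ → x∉F (subst (_∈ F) (x∈⁅y⁆⇒x≡y x y∈) y∈F)) , y∈F })
        (≤-reflexive (cong (_* N (1 + t)) (suc-injective (trans (∣remove∣ D x x∈D) D≡))))
      core : degree P? R ≤ s + (light + (2 + e) * N (1 + t))
      core = ≤-trans (degree-near P? t G R) (+-mono-≤ (almost G pG)
        (≤-trans (#-case (over good? R) (x ∈?_)) (+-mono-≤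
          (≤-trans (branchAt x) (light-degree (R ∪ ⁅ x ⁆) (∣R∪p∣ x (proj₂ (in-D x∈D))) ¬heavy)) rest)))
    ...   | no  none = inj₁ (R , R ∪ D , p⊆p∪q D , ∣R∣≡t , W≡ , contained , G , pG , R⊈G)
      where
      D = G ∩ ∁ R
      W≡ : ∣ R ∪ D ∣ ≡ suc (t + (2 + e))
      W≡ = begin-equality
        ∣ R ∪ D ∣                ≡⟨ ∣p∪q∣-disjoint R D (λ x∈R x∈D → proj₂ (∩∁⁻ G R x∈D) x∈R) ⟩
        ∣ R ∣ + ∣ D ∣            ≡⟨ cong (_+ ∣ D ∣) (trans ∣R∣≡t (sym (proj₂ (proj₂ (outside-pinned G pG R⊈G))))) ⟩
        suc (∣ G ∩ R ∣ + ∣ D ∣)  ≡⟨ cong suc (sym (∣p∣≡∣p∩q∣+∣p∩∁q∣ G R)) ⟩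
        suc ∣ G ∣                ≡⟨ cong suc (uniform G pG) ⟩
        suc (t + (2 + e))        ∎
        where open ≤-Reasoning
      -- All directions in `D` are heavy now, so `pinned` puts `D` into `F`; with the t - 1 points
      -- of `F` in `R` this makes k points, which is all of `F`.
      contained : ∀ F → P F → R ⊈ F → F ⊆ R ∪ D
      contained F p R⊈F = card-⊆ (s≤s⁻¹ (begin
        suc ∣ F ∣                ≡⟨ cong suc (trans (uniform F p) (sym (uniform G pG))) ⟩
        suc ∣ G ∣                ≡⟨ cong suc (∣p∣≡∣p∩q∣+∣p∩∁q∣ G R) ⟩
        suc ∣ G ∩ R ∣ + ∣ D ∣    ≡⟨ cong (_+ ∣ D ∣) (trans (proj₂ (proj₂ (outside-pinned G pG R⊈G)))
                                      (sym (proj₂ (proj₂ (outside-pinned F p R⊈F))))) ⟩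
        suc (∣ F ∩ R ∣ + ∣ D ∣)  ≡⟨ cong suc (sym (∣p∪q∣-disjoint (F ∩ R) D
                                      (λ x∈ x∈D → proj₂ (∩∁⁻ G R x∈D) (p∩q⊆q F R x∈)))) ⟩
        suc ∣ (F ∩ R) ∪ D ∣      ≤⟨ s≤s (p⊆q⇒∣p∣≤∣q∣ (∪-⊆ (∩-mono id (p⊆p∪q D))
                                      (λ x∈D → x∈p∩q⁺ (D⊆F x∈D , q⊆p∪q R D x∈D)))) ⟩
        suc ∣ F ∩ (R ∪ D) ∣      ∎))
        where
        open ≤-Reasoning
        D⊆F : D ⊆ F
        D⊆F {x} x∈D with heavy? (R ∪ ⁅ x ⁆)
        ... | yes heavy = proj₁ (pinned R F x ∣R∣≡t R⊈F (heavy-cover (R ∪ ⁅ x ⁆) heavy F p))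
        ... | no ¬heavy = ⊥-elim (none (x , x∈D , ¬heavy))

  -- Almost covers, for families with at most one heavy set

  AlmostCover : Subset n → Set
  AlmostCover S = # (far P? t S) ≤ s

  almostCover? : Decidable AlmostCover
  almostCover? S = # (far P? t S) ≤? s

  -- Members over the single heavy set are set aside at a cost of `N (1 + t)`. For the others every
  -- (t + 1)-set behaves as light, so a t-subset of `K` is branched once to reach sets of degree at
  -- most `light`.
  unique-heavy : (∀ L L′ → Heavy L → Heavy L′ → L ≡ L′) →
                 ∀ K → ∣ K ∣ ≡ suc t → AlmostCover K →
                 # P? ≤ N (1 + t) + (s + (t + 1) * (s + (3 + e) * light))
  unique-heavy unique K K≡ cover = bound (core (anySubset? heavy?))
    where
    core : Dec (∃ Heavy) → ∃ λ L₀ → ∣ L₀ ∣ ≡ suc t × (∀ L → Heavy L → L₀ ⊆ L)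
    core (yes (L₀ , heavy)) = L₀ , proj₁ heavy , λ L h → subst (L₀ ⊆_) (unique L₀ L heavy h) ⊆-refl
    -- Without heavy sets any (t + 1)-set may be set aside; `K` is at hand.
    core (no none)          = K , K≡ , λ L h → ⊥-elim (none (L , h))
    bound : (∃ λ L₀ → ∣ L₀ ∣ ≡ suc t × (∀ L → Heavy L → L₀ ⊆ L)) → _
    bound (L₀ , L₀≡ , below) = begin
      # P?                     ≤⟨ #-case P? (L₀ ⊆?_) ⟩
      degree P? L₀ + # rest?   ≤⟨ +-mono-≤ (degree-≤ L₀ (1 + t) L₀≡ (≤-trans (n≤1+n _) 2+t≤k))
        (≤-trans (#-near rest? t K) (+-mono-≤
          (≤-trans (#-mono (far rest? t K) (far P? t K) λ { F ((p , _) , lt) → p , lt }) cover)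
          (#-by-subsets good? K t (s + (3 + e) * light) each λ { F (_ , t≤) → t≤ }))) ⟩
      N (1 + t) + (s + binom ∣ K ∣ t * (s + (3 + e) * light))
        ≡⟨ cong (λ b → N (1 + t) + (s + b * (s + (3 + e) * light))) choose ⟩
      N (1 + t) + (s + (t + 1) * (s + (3 + e) * light)) ∎
      where
      open ≤-Reasoning
      rest? : Decidable (λ F → P F × L₀ ⊈ F)
      rest? F = P? F ×-dec ¬? (L₀ ⊆? F)
      good? = near rest? t K
      choose : binom ∣ K ∣ t ≡ t + 1
      choose = trans (cong (λ m → binom m t) K≡)
        (trans (binom-sym 1 t) (trans (binom-one (1 + t)) (+-comm 1 t)))
      each : ∀ R → R ⊆ K → ∣ R ∣ ≡ t → degree good? R ≤ s + (3 + e) * light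
      each R _ R≡ = let G , pG , R⊈G = escape R (≤-reflexive (sym R≡)) in
        degree-branch good? t (2 + e) s R G light (uniform G pG) (subst (∣ R ∩ G ∣ <_) R≡ (⊈-card R⊈G))
          (≤-trans (#-mono (far good? t G) (far P? t G) λ { F (((p , _) , _) , lt) → p , lt }) (almost G pG))
          extend
        where
        extend : ∀ {G} x → x ∈ G → x ∉ R → degree good? (R ∪ ⁅ x ⁆) ≤ light
        extend x _ x∉R with heavy? (R ∪ ⁅ x ⁆)
        -- A heavy R ∪ ⁅ x ⁆ contains `L₀`, whereas the members still counted do not.
        ... | yes heavy = ≤-trans (≤-reflexive (#-empty (over good? (R ∪ ⁅ x ⁆))
          λ { F (((_ , L₀⊈F) , _) , R∪x⊆F) → L₀⊈F (R∪x⊆F ∘ below _ heavy) })) z≤n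
        ... | no ¬heavy = ≤-trans (degree-mono good? P? (R ∪ ⁅ x ⁆) λ F → proj₁ ∘ proj₁)
          (light-degree (R ∪ ⁅ x ⁆) (trans (∣insert∣ R x x∉R) (cong suc R≡)) ¬heavy)

  NoAlmostCover : ℕ → Set
  NoAlmostCover m = ∀ S → ∣ S ∣ ≡ m → ¬ AlmostCover S

  -- As long as `S` has at most m points, it sits in an m-set that is not an almost cover; a member
  -- far from that m-set meets `S` in fewer than t points too and serves for the next branching.
  branching : ∀ m → suc m ≤ t + (2 + e) → NoAlmostCover m → ∀ j S → ∣ S ∣ + j ≡ m →
              degree P? S ≤ (4 + e) ^ j * (s + (3 + e) * N (suc m))
  branching m m<k none j S eq with super-of-size S m (≤-trans (m≤m+n ∣ S ∣ j) (≤-reflexive eq))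
                                     (≤-trans (n≤1+n m) (≤-trans m<k k≤n))
  ... | S′ , S⊆S′ , S′≡ with #-exists (far P? t S′) (≤-trans (s≤s z≤n) (≰⇒> (none S′ S′≡)))
  ...   | G , pG , lt = ≤-trans
    (degree-branch P? t (2 + e) s S G _ (uniform G pG) S∩G<t (almost G pG) (next j eq))
    (absorb j)
    where
    base = s + (3 + e) * N (suc m)
    child : ℕ → ℕ
    child zero    = N (suc m)
    child (suc j) = (4 + e) ^ j * base
    S∩G<t : ∣ S ∩ G ∣ < t
    S∩G<t = ≤-<-trans (p⊆q⇒∣p∣≤∣q∣ λ x∈ → let x∈S , x∈G = x∈p∩q⁻ S G x∈ in x∈p∩q⁺ (x∈G , S⊆S′ x∈S)) lt
    next : ∀ j → ∣ S ∣ + j ≡ m → ∀ x → x ∈ G → x ∉ S → degree P? (S ∪ ⁅ x ⁆) ≤ child j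
    next zero    eq x _ x∉S = degree-≤ (S ∪ ⁅ x ⁆) (suc m)
      (trans (∣insert∣ S x x∉S) (cong suc (trans (sym (+-identityʳ _)) eq))) m<k
    next (suc j) eq x _ x∉S = branching m m<k none j (S ∪ ⁅ x ⁆)
      (trans (cong (_+ j) (∣insert∣ S x x∉S)) (trans (sym (+-suc ∣ S ∣ j)) eq))
    -- A branching has d + 1 = 3 + e children; the base 4 + e has one unit more, which swallows the
    -- additive `s`.
    absorb : ∀ j → s + (3 + e) * child j ≤ (4 + e) ^ j * base
    absorb zero    = ≤-reflexive (sym (*-identityˡ base))
    absorb (suc j) = ≤-trans (+-monoˡ-≤ ((3 + e) * child (suc j))
        (≤-trans (m≤m+n s _) (≤-trans (≤-reflexive (sym (*-identityˡ base)))
          (*-monoˡ-≤ base (m^n>0 (4 + e) j)))))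
      (≤-reflexive (sym (*-assoc (4 + e) ((4 + e) ^ j) base)))

  coverBound : ℕ → ℕ
  coverBound j = binom (2 + (j + t)) (2 + j) * (4 + e) ^ (1 + j) * (s + (3 + e) * N (2 + (j + t)))

  cover-size : ∀ j → 2 + (j + t) ≤ t + (2 + e) → NoAlmostCover (1 + (j + t)) →
               ∀ S → ∣ S ∣ ≡ 2 + (j + t) → AlmostCover S → # P? ≤ s + coverBound j
  cover-size j le none S S≡ cover = begin
    # P?                                        ≤⟨ #-near P? t S ⟩
    # (far P? t S) + # good?                                 ≤⟨ +-mono-≤ cover (#-by-subsets good? S t b each (λ F → proj₂)) ⟩
    s + binom ∣ S ∣ t * b                       ≡⟨ cong (λ x → s + x * b) (trans (cong (λ m → binom m t) S≡) (binom-sym (2 + j) t)) ⟩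
    s + binom (2 + (j + t)) (2 + j) * b         ≡⟨ cong (s +_) (sym (*-assoc (binom (2 + (j + t)) (2 + j)) ((4 + e) ^ (1 + j)) _)) ⟩
    s + coverBound j                            ∎
    where
    open ≤-Reasoning
    b = (4 + e) ^ (1 + j) * (s + (3 + e) * N (2 + (j + t)))
    good? = near P? t S
    each : ∀ R → R ⊆ S → ∣ R ∣ ≡ t → degree good? R ≤ b
    each R _ R≡ = ≤-trans (degree-mono good? P? R (λ F → proj₁))
      (branching (1 + (j + t)) le none (1 + j) R (trans (cong (_+ (1 + j)) R≡) (+-comm t (1 + j))))

  -- Every member is an almost cover of size k, so the descent can start there. It stops when no
  -- almost cover has one point less, which is exactly what `branching` needs.
  cover-descent : ∀ j → 1 + (j + t) ≤ t + (2 + e) → (∃ λ S → ∣ S ∣ ≡ 1 + (j + t) × AlmostCover S) →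
    (∃ λ K → ∣ K ∣ ≡ 1 + t × AlmostCover K) ⊎ (∃ λ i → 2 + (i + t) ≤ t + (2 + e) × # P? ≤ s + coverBound i)
  cover-descent zero    _  found = inj₁ found
  cover-descent (suc j) le (S , S≡ , cover)
    with anySubset? (λ S → (∣ S ∣ ≟ 1 + (j + t)) ×-dec almostCover? S)
  ... | yes found = cover-descent j (≤-trans (n≤1+n _) le) found
  ... | no  none  = inj₂ (j , le , cover-size j le (λ S S≡ c → none (S , S≡ , c)) S S≡ cover)

-- Relabelling the ground set

module _ {n : ℕ} (σ : Permutation′ n) where

  lookup-image : ∀ F i → lookup (image σ F) i ≡ lookup F (σ ⟨$⟩ˡ i)
  lookup-image F = lookup∘tabulate (λ i → lookup F (σ ⟨$⟩ˡ i))

  image-flip : ∀ F → image (flip σ) (image σ F) ≡ F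
  image-flip F = trans (tabulate-cong λ i → trans (lookup-image F (σ ⟨$⟩ʳ i)) (cong (lookup F) (inverseˡ σ)))
    (tabulate∘lookup F)

  flip-image : ∀ F → image σ (image (flip σ) F) ≡ F
  flip-image F = trans (tabulate-cong λ i →
      trans (lookup∘tabulate (λ i → lookup F (σ ⟨$⟩ʳ i)) (σ ⟨$⟩ˡ i)) (cong (lookup F) (inverseʳ σ)))
    (tabulate∘lookup F)

  image-injective : ∀ {F G} → image σ F ≡ image σ G → F ≡ G
  image-injective {F} {G} eq = trans (sym (image-flip F)) (trans (cong (image (flip σ)) eq) (image-flip G))

  image-∩ : ∀ F G → image σ (F ∩ G) ≡ image σ F ∩ image σ G
  image-∩ F G = trans (tabulate-cong λ i → trans (lookup-zipWith _∧_ (σ ⟨$⟩ˡ i) F G)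
      (trans (sym (cong₂ _∧_ (lookup-image F i) (lookup-image G i))) (sym (lookup-zipWith _∧_ i (image σ F) (image σ G)))))
    (tabulate∘lookup (image σ F ∩ image σ G))

  image-⊆ : ∀ {F G} → F ⊆ G → image σ F ⊆ image σ G
  image-⊆ {F} {G} F⊆G = p∩q≡p⇒p⊆q (trans (sym (image-∩ F G)) (cong (image σ) (p⊆q⇒p∩q≡p F⊆G)))

  image-⊆⁻ : ∀ {F G} → image σ F ⊆ image σ G → F ⊆ G
  image-⊆⁻ {F} {G} le = p∩q≡p⇒p⊆q (image-injective (trans (image-∩ F G) (p⊆q⇒p∩q≡p le)))

bit : Bool → ℕ
bit true  = 1
bit false = 0

card-sum : ∀ {n} (F : Subset n) → ∣ F ∣ ≡ sum (bit ∘ lookup F)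
card-sum []          = refl
card-sum (true  ∷ F) = cong suc (card-sum F)
card-sum (false ∷ F) = card-sum F

-- As a sum of bits over all positions, cardinality is invariant under permuting the positions.
∣image∣ : ∀ {n} (σ : Permutation′ n) F → ∣ image σ F ∣ ≡ ∣ F ∣
∣image∣ σ F = begin
  ∣ image σ F ∣                                  ≡⟨ card-sum (image σ F) ⟩
  sum (bit ∘ lookup (image σ F))                 ≡⟨ sum-cong-≗ (cong bit ∘ lookup-image σ F) ⟩
  sum (λ i → bit (lookup F (σ ⟨$⟩ˡ i)))          ≡⟨ sym (sum-permute (bit ∘ lookup F) (flip σ)) ⟩
  sum (bit ∘ lookup F)                           ≡⟨ sym (card-sum F) ⟩
  ∣ F ∣                                          ∎
  where open ≡-Reasoning

punchIn-below : ∀ {n} (j : Fin (suc n)) i m → toℕ j ≤ m → (toℕ (punchIn j i) <ᵇ suc m) ≡ (toℕ i <ᵇ m)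
punchIn-below zero    i       m       _         = refl
punchIn-below (suc j) zero    (suc m) _         = refl
punchIn-below (suc j) (suc i) (suc m) (s≤s j≤m) = punchIn-below j i m j≤m

punchIn-above : ∀ {n} (j : Fin (suc n)) i m → m ≤ toℕ j → (toℕ (punchIn j i) <ᵇ m) ≡ (toℕ i <ᵇ m)
punchIn-above j       i       zero    _         = refl
punchIn-above (suc j) zero    (suc m) _         = refl
punchIn-above (suc j) (suc i) (suc m) (s≤s m≤j) = punchIn-above j i m m≤j

<ᵇ-true : ∀ {a b} → a < b → (a <ᵇ b) ≡ true
<ᵇ-true {zero}  (s≤s _)   = refl
<ᵇ-true {suc a} (s≤s a<b) = <ᵇ-true a<b

<ᵇ-false : ∀ {a b} → b ≤ a → (a <ᵇ b) ≡ false
<ᵇ-false {a}     z≤n       = refl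
<ᵇ-false {suc a} (s≤s b≤a) = <ᵇ-false b≤a

image-insert : ∀ {n} (π : Permutation′ n) j b F m′ m → image π F ≡ [ m ]ₛ → (toℕ j <ᵇ m′) ≡ b →
               (∀ i → (toℕ (punchIn j i) <ᵇ m′) ≡ (toℕ i <ᵇ m)) →
               image (insert zero j π) (b ∷ F) ≡ [ m′ ]ₛ
image-insert π j b F m′ m eq at-j elsewhere = tabulate-cong position
  where
  ρ = insert zero j π
  open ≡-Reasoning
  position : ∀ k → lookup (b ∷ F) (ρ ⟨$⟩ˡ k) ≡ (toℕ k <ᵇ m′)
  position k with j Fin.≟ k
  ... | yes refl = sym at-j
  ... | no  j≢k  = let i = punchOut j≢k in begin
    lookup F (π ⟨$⟩ˡ i)         ≡⟨ sym (lookup-image π F i) ⟩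
    lookup (image π F) i        ≡⟨ cong (λ G → lookup G i) eq ⟩
    lookup [ m ]ₛ i             ≡⟨ lookup∘tabulate (λ i → toℕ i <ᵇ m) i ⟩
    (toℕ i <ᵇ m)                ≡⟨ sym (elsewhere i) ⟩
    (toℕ (punchIn j i) <ᵇ m′)   ≡⟨ cong (λ l → toℕ l <ᵇ m′) (punchIn-punchOut j≢k) ⟩
    (toℕ k <ᵇ m′)               ∎

insert-below : ∀ {n} (π : Permutation′ n) j F m → image π F ≡ [ m ]ₛ → toℕ j ≤ m →
               image (insert zero j π) (true ∷ F) ≡ [ suc m ]ₛ
insert-below π j F m eq j≤m = image-insert π j true F (suc m) m eq (<ᵇ-true (s≤s j≤m))
  (λ i → punchIn-below j i m j≤m)

insert-above : ∀ {n} (π : Permutation′ n) j F m → image π F ≡ [ m ]ₛ → m ≤ toℕ j →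
               image (insert zero j π) (false ∷ F) ≡ [ m ]ₛ
insert-above π j F m eq m≤j = image-insert π j false F m m eq (<ᵇ-false m≤j)
  (λ i → punchIn-above j i m m≤j)

-- A single permutation must serve both sets. The new first point goes to position 0 if it lies in
-- `R`, right behind the segment of `R` if it lies only in `W`, and right behind the segment of `W`
-- otherwise; each choice keeps both images initial segments.
straighten : ∀ {n} (R W : Subset n) → R ⊆ W →
             ∃ λ (σ : Permutation′ n) → image σ R ≡ [ ∣ R ∣ ]ₛ × image σ W ≡ [ ∣ W ∣ ]ₛ
straighten []         []          _   = Perm.id , refl , refl
straighten (a ∷ R)    (b ∷ W)     R⊆W with straighten R W (drop-∷-⊆ R⊆W)
straighten (true  ∷ R) (true  ∷ W) R⊆W | π , eqR , eqW =
  insert zero zero π , insert-below π zero R (∣ R ∣) eqR z≤n , insert-below π zero W (∣ W ∣) eqW z≤n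
straighten (true  ∷ R) (false ∷ W) R⊆W | _ with () ← R⊆W here
straighten (false ∷ R) (true  ∷ W) R⊆W | π , eqR , eqW =
  insert zero j π , insert-above π j R (∣ R ∣) eqR (≤-reflexive (sym j≡)) ,
  insert-below π j W (∣ W ∣) eqW (≤-trans (≤-reflexive j≡) (p⊆q⇒∣p∣≤∣q∣ (drop-∷-⊆ R⊆W)))
  where
  j = fromℕ< (s≤s (∣p∣≤n R))
  j≡ : toℕ j ≡ ∣ R ∣
  j≡ = toℕ-fromℕ< (s≤s (∣p∣≤n R))
straighten (false ∷ R) (false ∷ W) R⊆W | π , eqR , eqW =
  insert zero j π , insert-above π j R (∣ R ∣) eqR (≤-trans (p⊆q⇒∣p∣≤∣q∣ (drop-∷-⊆ R⊆W)) (≤-reflexive (sym j≡))) ,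
  insert-above π j W (∣ W ∣) eqW (≤-reflexive (sym j≡))
  where
  j = fromℕ< (s≤s (∣p∣≤n W))
  j≡ : toℕ j ≡ ∣ W ∣
  j≡ = toℕ-fromℕ< (s≤s (∣p∣≤n W))

-- The extremal pattern

T-ext : ∀ {a b} → (T a → T b) → (T b → T a) → a ≡ b
T-ext {true}  {true}  _ _ = refl
T-ext {true}  {false} f _ = ⊥-elim (f _)
T-ext {false} {true}  _ g = ⊥-elim (g _)
T-ext {false} {false} _ _ = refl

T-∨⁻ : ∀ a {b} → T (a ∨ b) → T a ⊎ T b
T-∨⁻ true  _ = inj₁ _
T-∨⁻ false h = inj₂ h

T-∨⁺ : ∀ a {b} → T a ⊎ T b → T (a ∨ b)
T-∨⁺ true  _        = _
T-∨⁺ false (inj₂ h) = h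

T-∧⁻ : ∀ a {b} → T (a ∧ b) → T a × T b
T-∧⁻ true h = _ , h

T-∧⁺ : ∀ {a b} → T a → T b → T (a ∧ b)
T-∧⁺ {true} _ h = h

far-count : ∀ {n} t (𝓖 : Family n) F →
            count (λ F′ → 𝓖 F′ ∧ (∣ F′ ∩ F ∣ <ᵇ t)) ≡ # (far (λ F → T? (𝓖 F)) t F)
far-count t 𝓖 F = trans (size-# (λ F′ → 𝓖 F′ ∧ (∣ F′ ∩ F ∣ <ᵇ t)))
  (#-cong (λ F′ → T? (𝓖 F′ ∧ (∣ F′ ∩ F ∣ <ᵇ t))) (far (λ F → T? (𝓖 F)) t F)
    (λ F′ h → let g , lt = T-∧⁻ (𝓖 F′) h in g , <ᵇ⇒< _ _ lt)
    (λ F′ (g , lt) → T-∧⁺ g (<⇒<ᵇ lt)))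

module Pattern {n t e : ℕ} (R W : Subset n) (R⊆W : R ⊆ W) (R≡ : ∣ R ∣ ≡ t)
               (W≡ : ∣ W ∣ ≡ suc (t + (2 + e))) where

  k : ℕ
  k = t + (2 + e)

  -- With `R` and `W` in place of [t] and [k + 1], these are `HFam` and the pools from which the
  -- families 𝓐 and 𝓑 are chosen.
  Stars Tips Crowns : Subset n → Set
  Stars  F = ∣ F ∣ ≡ k × R ⊆ F × suc t ≤ ∣ F ∩ W ∣
  Tips   F = Trace k W R F
  Crowns F = ∣ F ∣ ≡ k × F ⊆ W × R ⊈ F

  stars? : Decidable Stars
  stars? F = (∣ F ∣ ≟ k) ×-dec (R ⊆? F) ×-dec (suc t ≤? ∣ F ∩ W ∣)

  tips? : Decidable Tips
  tips? = trace? k W R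

  crowns? : Decidable Crowns
  crowns? F = (∣ F ∣ ≟ k) ×-dec (F ⊆? W) ×-dec ¬? (R ⊆? F)

  tip-⊇ : ∀ F → Tips F → R ⊆ F
  tip-⊇ F (_ , eq) x∈R = p∩q⊆p F W (subst (_ ∈_) (sym eq) x∈R)

  over-meet : ∀ F F′ → R ⊆ F → R ⊆ F′ → t ≤ ∣ F ∩ F′ ∣
  over-meet F F′ f f′ = ≤-trans (≤-reflexive (sym R≡)) (p⊆q⇒∣p∣≤∣q∣ λ x∈R → x∈p∩q⁺ (f x∈R , f′ x∈R))

  star-crown : ∀ F B → suc t ≤ ∣ F ∩ W ∣ → ∣ B ∣ ≡ k → B ⊆ W → t ≤ ∣ F ∩ B ∣
  star-crown F B le B≡ B⊆W = +-cancelˡ-≤ (suc k) _ _ (begin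
    suc k + t                        ≡⟨ cong suc (+-comm k t) ⟩
    suc t + k                        ≤⟨ +-mono-≤ le (≤-reflexive (sym B≡)) ⟩
    ∣ F ∩ W ∣ + ∣ B ∣                ≤⟨ ∣p∣+∣q∣≤∣r∣+∣p∩q∣ (p∩q⊆q F W) B⊆W ⟩
    ∣ W ∣ + ∣ (F ∩ W) ∩ B ∣          ≤⟨ +-mono-≤ (≤-reflexive W≡) (p⊆q⇒∣p∣≤∣q∣ (∩-mono (p∩q⊆p F W) id)) ⟩
    suc k + ∣ F ∩ B ∣                ∎)
    where open ≤-Reasoning

  crown-star : ∀ B F → ∣ B ∣ ≡ k → B ⊆ W → suc t ≤ ∣ F ∩ W ∣ → t ≤ ∣ B ∩ F ∣
  crown-star B F B≡ B⊆W le = subst (t ≤_) (cong ∣_∣ (∩-comm F B)) (star-crown F B le B≡ B⊆W)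

  -- Lets a crown stand in for the first set in `star-crown`, so that two crowns also meet in t
  -- points.
  crown-large : ∀ B → ∣ B ∣ ≡ k → B ⊆ W → suc t ≤ ∣ B ∩ W ∣
  crown-large B B≡ B⊆W = begin
    suc t          ≤⟨ ≤-trans (≤-reflexive (+-comm 1 t)) (+-monoʳ-≤ t (s≤s z≤n)) ⟩
    k              ≡⟨ sym B≡ ⟩
    ∣ B ∣          ≡⟨ cong ∣_∣ (sym (p⊆q⇒p∩q≡p B⊆W)) ⟩
    ∣ B ∩ W ∣      ∎
    where open ≤-Reasoning

  -- Every tip is far from every crown, and these are the only far pairs in the pattern; this is
  -- what ties the sizes of 𝓐 and 𝓑 to s.
  tip-crown : ∀ A B → Tips A → B ⊆ W → R ⊈ B → ∣ A ∩ B ∣ < t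
  tip-crown A B (_ , A∩W≡R) B⊆W R⊈B = ≤-<-trans
    (p⊆q⇒∣p∣≤∣q∣ λ x∈ → let x∈A , x∈B = x∈p∩q⁻ A B x∈ in
      x∈p∩q⁺ (subst (_ ∈_) A∩W≡R (x∈p∩q⁺ (x∈A , B⊆W x∈B)) , x∈B))
    (subst (∣ R ∩ B ∣ <_) R≡ (⊈-card R⊈B))

  crown-tip : ∀ A B → Tips A → B ⊆ W → R ⊈ B → ∣ B ∩ A ∣ < t
  crown-tip A B tip B⊆W R⊈B = subst (_< t) (cong ∣_∣ (∩-comm A B)) (tip-crown A B tip B⊆W R⊈B)

  star-or-tip : ∀ F → ∣ F ∣ ≡ k → R ⊆ F → Stars F ⊎ Tips F
  star-or-tip F F≡ R⊆F with suc t ≤? ∣ F ∩ W ∣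
  ... | yes le = inj₁ (F≡ , R⊆F , le)
  ... | no ¬le = inj₂ (F≡ , sym (⊆-card-≡ (λ x∈R → x∈p∩q⁺ (R⊆F x∈R , R⊆W x∈R))
          (≤-trans (s≤s⁻¹ (≰⇒> ¬le)) (≤-reflexive (sym R≡)))))

  suc-k≤n : suc k ≤ n
  suc-k≤n = ≤-trans (≤-reflexive (sym W≡)) (∣p∣≤n W)

  #-tips : # tips? ≡ binom (n ∸ suc k) (2 + e)
  #-tips = trans (#-trace k W R (p⊆q⇒p∩q≡p R⊆W) (≤-trans (≤-reflexive R≡) (m≤m+n t _)))
    (cong₂ binom (cong (n ∸_) W≡) (trans (cong (k ∸_) R≡) (m+n∸m≡n t (2 + e))))

  #-stars : # stars? + binom (n ∸ suc k) (2 + e) ≡ binom (n ∸ t) (2 + e)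
  #-stars = begin
    # stars? + binom (n ∸ suc k) (2 + e)  ≡⟨ cong (# stars? +_) (sym #-tips) ⟩
    # stars? + # tips?                    ≡⟨ ≤-antisym
      (#-disjoint stars? tips? (trace? k R R)
        (λ { F (F≡ , R⊆F , _) → F≡ , trace-R F R⊆F }) (λ { F tip → proj₁ tip , trace-R F (tip-⊇ F tip) })
        (λ { F (_ , _ , le) (_ , eq) → <⇒≱ le (≤-reflexive (trans (cong ∣_∣ eq) R≡)) }))
      (#-split (trace? k R R) stars? tips?
        λ { F (F≡ , eq) → star-or-tip F F≡ (p∩q≡p⇒p⊆q (trans (∩-comm R F) eq)) }) ⟩
    # (trace? k R R)                      ≡⟨ #-trace k R R (∩-idem R) (≤-trans (≤-reflexive R≡) (m≤m+n t _)) ⟩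
    binom (n ∸ ∣ R ∣) (k ∸ ∣ R ∣)         ≡⟨ cong₂ binom (cong (n ∸_) R≡) (trans (cong (k ∸_) R≡) (m+n∸m≡n t (2 + e))) ⟩
    binom (n ∸ t) (2 + e)                 ∎
    where
    open ≡-Reasoning
    trace-R : ∀ F → R ⊆ F → F ∩ R ≡ R
    trace-R F R⊆F = trans (∩-comm F R) (p⊆q⇒p∩q≡p R⊆F)

  binom-suc-self : ∀ a → binom (suc a) a ≡ suc a
  binom-suc-self a = trans (binom-sym 1 a) (binom-one (suc a))

  -- A crown is `W` without one point of `R`. In terms of traces, the k + 1 subsets of `W` of size k
  -- split into crowns and the d + 1 sets that omit a point of `W` outside `R`.
  #-crowns : # crowns? ≡ t
  #-crowns = +-cancelʳ-≡ (3 + e) _ _ (begin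
    # crowns? + (3 + e)                       ≡⟨ cong (# crowns? +_) (sym over-card) ⟩
    # crowns? + # (trace? k (∁ W ∪ R) R)      ≡⟨ ≤-antisym
      (#-disjoint crowns? (trace? k (∁ W ∪ R) R) (trace? k (∁ W) ⊥)
        (λ { F (F≡ , F⊆W , _) → F≡ , within⁺ F F⊆W })
        (λ { F (F≡ , eq) → F≡ , within⁺ F (proj₁ (over⁻ F eq)) })
        (λ { F (_ , _ , R⊈F) (_ , eq) → R⊈F (proj₂ (over⁻ F eq)) }))
      (#-split (trace? k (∁ W) ⊥) crowns? (trace? k (∁ W ∪ R) R)
        λ { F (F≡ , eq) → case F F≡ (within⁻ F eq) (R ⊆? F) }) ⟩
    # (trace? k (∁ W) ⊥)                      ≡⟨ within-card ⟩
    suc k                                     ≡⟨ sym (+-suc t (2 + e)) ⟩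
    t + (3 + e)                               ∎)
    where
    open ≡-Reasoning
    case : ∀ F → ∣ F ∣ ≡ k → F ⊆ W → Dec (R ⊆ F) → Crowns F ⊎ Trace k (∁ W ∪ R) R F
    within⁺ : ∀ F → F ⊆ W → F ∩ ∁ W ≡ ⊥
    within⁺ F F⊆W = Empty-unique λ { (x , x∈) → let x∈F , x∉W = ∩∁⁻ F W x∈ in x∉W (F⊆W x∈F) }
    within⁻ : ∀ F → F ∩ ∁ W ≡ ⊥ → F ⊆ W
    within⁻ F eq {x} x∈F with x ∈? W
    ... | yes x∈W = x∈W
    ... | no  x∉W = ⊥-elim (∉⊥ (subst (x ∈_) eq (∩∁⁺ x∈F x∉W)))
    over⁺ : ∀ F → F ⊆ W → R ⊆ F → F ∩ (∁ W ∪ R) ≡ R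
    over⁺ F F⊆W R⊆F = ⊆-antisym
      (λ x∈ → let x∈F , x∈∪ = x∈p∩q⁻ F (∁ W ∪ R) x∈ in
        [ (λ x∈∁W → ⊥-elim (x∈∁p⇒x∉p x∈∁W (F⊆W x∈F))) , id ]′ (x∈p∪q⁻ (∁ W) R x∈∪))
      (λ x∈R → x∈p∩q⁺ (R⊆F x∈R , q⊆p∪q (∁ W) R x∈R))
    over⁻ : ∀ F → F ∩ (∁ W ∪ R) ≡ R → F ⊆ W × R ⊆ F
    over⁻ F eq = F⊆W , λ x∈R → p∩q⊆p F (∁ W ∪ R) (subst (_ ∈_) (sym eq) x∈R)
      where
      F⊆W : F ⊆ W
      F⊆W {x} x∈F with x ∈? W
      ... | yes x∈W = x∈W
      ... | no  x∉W = R⊆W (subst (x ∈_) eq (x∈p∩q⁺ (x∈F , p⊆p∪q R (x∉p⇒x∈∁p x∉W))))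
    case F F≡ F⊆W (yes R⊆F) = inj₂ (F≡ , over⁺ F F⊆W R⊆F)
    case F F≡ F⊆W (no  R⊈F) = inj₁ (F≡ , F⊆W , R⊈F)
    ∁W≡ : ∣ ∁ W ∣ ≡ n ∸ suc k
    ∁W≡ = trans (∣∁p∣≡n∸∣p∣ W) (cong (n ∸_) W≡)
    within-card : # (trace? k (∁ W) ⊥) ≡ suc k
    within-card = begin
      # (trace? k (∁ W) ⊥)                 ≡⟨ #-trace k (∁ W) ⊥ (p⊆q⇒p∩q≡p {p = ⊥} {q = ∁ W} ⊥⊆) (≤-trans (≤-reflexive (∣⊥∣≡0 n)) z≤n) ⟩
      binom (n ∸ ∣ ∁ W ∣) (k ∸ ∣ ⊥ {n} ∣)  ≡⟨ cong₂ binom (trans (cong (n ∸_) ∁W≡) (m∸[m∸n]≡n suc-k≤n)) (cong (k ∸_) (∣⊥∣≡0 n)) ⟩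
      binom (suc k) k                      ≡⟨ binom-suc-self k ⟩
      suc k                                ∎
    over-card : # (trace? k (∁ W ∪ R) R) ≡ 3 + e
    over-card = begin
      # (trace? k (∁ W ∪ R) R)                     ≡⟨ #-trace k (∁ W ∪ R) R (p⊆q⇒p∩q≡p (q⊆p∪q (∁ W) R)) (≤-trans (≤-reflexive R≡) (m≤m+n t _)) ⟩
      binom (n ∸ ∣ ∁ W ∪ R ∣) (k ∸ ∣ R ∣)          ≡⟨ cong₂ binom room (trans (cong (k ∸_) R≡) (m+n∸m≡n t (2 + e))) ⟩
      binom (3 + e) (2 + e)                        ≡⟨ binom-suc-self (2 + e) ⟩
      3 + e                                        ∎
      where
      room : n ∸ ∣ ∁ W ∪ R ∣ ≡ 3 + e
      room = begin
        n ∸ ∣ ∁ W ∪ R ∣           ≡⟨ cong (n ∸_) (∣p∪q∣-disjoint (∁ W) R (λ x∈∁W x∈R → x∈∁p⇒x∉p x∈∁W (R⊆W x∈R))) ⟩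
        n ∸ (∣ ∁ W ∣ + ∣ R ∣)     ≡⟨ cong₂ (λ a b → n ∸ (a + b)) ∁W≡ R≡ ⟩
        n ∸ (n ∸ suc k + t)       ≡⟨ sym (∸-+-assoc n (n ∸ suc k) t) ⟩
        n ∸ (n ∸ suc k) ∸ t       ≡⟨ cong (_∸ t) (m∸[m∸n]≡n suc-k≤n) ⟩
        suc k ∸ t                 ≡⟨ cong (_∸ t) (sym (+-suc t (2 + e))) ⟩
        t + (3 + e) ∸ t           ≡⟨ m+n∸m≡n t (3 + e) ⟩
        3 + e                     ∎

  Candidate : ℕ → Set
  Candidate s = Σ (Family n) λ 𝓖 → Uniform k 𝓖 × AlmostIntersecting s t 𝓖 × (¬ Intersecting t 𝓖) ×
    # stars? + (s + t ⊓ s) ≤ size 𝓖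

  -- A chosen crown is far from the s chosen tips only, and any other member at most from the chosen
  -- crowns, of which there are at most s. Positivity of s and t provides a tip and a crown, hence a
  -- far pair.
  assemble : ∀ s → 0 < t → 0 < s →
    (Σ (Family n) λ 𝓐 → (∀ F → T (𝓐 F) → T ⌊ tips? F ⌋) × size 𝓐 ≡ s) →
    (Σ (Family n) λ 𝓑 → (∀ F → T (𝓑 F) → T ⌊ crowns? F ⌋) × size 𝓑 ≡ t ⊓ s) → Candidate s
  assemble s 0<t 0<s (𝓐 , 𝓐⊆ , 𝓐≡) (𝓑 , 𝓑⊆ , 𝓑≡) = 𝓖 , uniform , almost , crossing , large
    where
    tip : ∀ F → T (𝓐 F) → Tips F
    tip F a = toWitness (𝓐⊆ F a)
    crown : ∀ F → T (𝓑 F) → Crowns F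
    crown F b = toWitness (𝓑⊆ F b)
    Q : Subset n → Set
    Q F = Stars F ⊎ (T (𝓐 F) ⊎ T (𝓑 F))
    Q? : Decidable Q
    Q? F = stars? F ⊎-dec (T? (𝓐 F) ⊎-dec T? (𝓑 F))
    𝓖 : Family n
    𝓖 F = ⌊ Q? F ⌋
    uniform : Uniform k 𝓖
    uniform F g with toWitness {a? = Q? F} g
    ... | inj₁ star     = proj₁ star
    ... | inj₂ (inj₁ a) = proj₁ (tip F a)
    ... | inj₂ (inj₂ b) = proj₁ (crown F b)
    bad : ∀ F F′ → Q F → Q F′ → ∣ F′ ∩ F ∣ < t → (T (𝓐 F) × T (𝓑 F′)) ⊎ (T (𝓑 F) × T (𝓐 F′))
    bad F F′ (inj₁ (_ , f , _)) (inj₁ (_ , f′ , _)) lt = ⊥-elim (<⇒≱ lt (over-meet F′ F f′ f))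
    bad F F′ (inj₁ (_ , f , _)) (inj₂ (inj₁ a)) lt = ⊥-elim (<⇒≱ lt (over-meet F′ F (tip-⊇ F′ (tip F′ a)) f))
    bad F F′ (inj₁ (_ , _ , le)) (inj₂ (inj₂ b)) lt =
      ⊥-elim (<⇒≱ lt (crown-star F′ F (proj₁ (crown F′ b)) (proj₁ (proj₂ (crown F′ b))) le))
    bad F F′ (inj₂ (inj₁ a)) (inj₁ (_ , f′ , _)) lt = ⊥-elim (<⇒≱ lt (over-meet F′ F f′ (tip-⊇ F (tip F a))))
    bad F F′ (inj₂ (inj₁ a)) (inj₂ (inj₁ a′)) lt = ⊥-elim (<⇒≱ lt (over-meet F′ F (tip-⊇ F′ (tip F′ a′)) (tip-⊇ F (tip F a))))
    bad F F′ (inj₂ (inj₁ a)) (inj₂ (inj₂ b)) lt = inj₁ (a , b)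
    bad F F′ (inj₂ (inj₂ b)) (inj₁ (_ , _ , le)) lt =
      ⊥-elim (<⇒≱ lt (star-crown F′ F le (proj₁ (crown F b)) (proj₁ (proj₂ (crown F b)))))
    bad F F′ (inj₂ (inj₂ b)) (inj₂ (inj₁ a)) lt = inj₂ (b , a)
    bad F F′ (inj₂ (inj₂ b)) (inj₂ (inj₂ b′)) lt = let B≡ , B⊆W , _ = crown F b ; B′≡ , B′⊆W , _ = crown F′ b′ in
      ⊥-elim (<⇒≱ lt (star-crown F′ F (crown-large F′ B′≡ B′⊆W) B≡ B⊆W))
    tip≢crown : ∀ F → T (𝓐 F) → ¬ T (𝓑 F)
    tip≢crown F a b = proj₂ (proj₂ (crown F b)) (tip-⊇ F (tip F a))
    almost : AlmostIntersecting s t 𝓖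
    almost F g = ≤-trans (≤-reflexive (far-count t 𝓖 F)) (bound (T? (𝓑 F)))
      where
      bound : Dec (T (𝓑 F)) → # (far (λ F → T? (𝓖 F)) t F) ≤ s
      bound (yes b) = ≤-trans (#-mono (far (λ F → T? (𝓖 F)) t F) (λ F′ → T? (𝓐 F′))
          λ F′ (g′ , lt) → [ (λ { (a , _) → ⊥-elim (tip≢crown F a b) }) , proj₂ ]′
            (bad F F′ (toWitness g) (toWitness g′) lt))
        (≤-reflexive (trans (sym (size-# 𝓐)) 𝓐≡))
      bound (no ¬b) = ≤-trans (#-mono (far (λ F → T? (𝓖 F)) t F) (λ F′ → T? (𝓑 F′))
          λ F′ (g′ , lt) → [ proj₂ , (λ { (b , _) → ⊥-elim (¬b b) }) ]′
            (bad F F′ (toWitness g) (toWitness g′) lt))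
        (≤-trans (≤-reflexive (trans (sym (size-# 𝓑)) 𝓑≡)) (m⊓n≤n t s))
    crossing : ¬ Intersecting t 𝓖
    crossing int =
      let A , a = #-exists (λ F → T? (𝓐 F)) (subst (0 <_) (trans (sym 𝓐≡) (size-# 𝓐)) 0<s)
          B , b = #-exists (λ F → T? (𝓑 F)) (subst (0 <_) (trans (sym 𝓑≡) (size-# 𝓑)) (⊓-glb 0<t 0<s))
          _ , B⊆W , R⊈B = crown B b
      in <⇒≱ (tip-crown A B (tip A a) B⊆W R⊈B)
           (int A B (fromWitness {a? = Q? A} (inj₂ (inj₁ a))) (fromWitness {a? = Q? B} (inj₂ (inj₂ b))))
    large : # stars? + (s + t ⊓ s) ≤ size 𝓖
    large = begin
      # stars? + (s + t ⊓ s)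
        ≡⟨ cong (# stars? +_) (cong₂ _+_ (trans (sym 𝓐≡) (size-# 𝓐)) (trans (sym 𝓑≡) (size-# 𝓑))) ⟩
      # stars? + (# (λ F → T? (𝓐 F)) + # (λ F → T? (𝓑 F)))
        ≤⟨ +-monoʳ-≤ (# stars?) (#-disjoint (λ F → T? (𝓐 F)) (λ F → T? (𝓑 F)) ab?
             (λ _ → inj₁) (λ _ → inj₂) tip≢crown) ⟩
      # stars? + # ab?
        ≤⟨ #-disjoint stars? ab? Q? (λ _ → inj₁) (λ _ → inj₂) apart ⟩
      # Q? ∎
      where
      open ≤-Reasoning
      ab? : Decidable (λ F → T (𝓐 F) ⊎ T (𝓑 F))
      ab? F = T? (𝓐 F) ⊎-dec T? (𝓑 F)
      apart : ∀ F → Stars F → ¬ (T (𝓐 F) ⊎ T (𝓑 F))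
      apart F (_ , _ , le) (inj₁ a) = <⇒≱ le (≤-reflexive (trans (cong ∣_∣ (proj₂ (tip F a))) R≡))
      apart F (_ , R⊆F , _) (inj₂ b) = proj₂ (proj₂ (crown F b)) R⊆F

  candidate : ∀ s → 0 < t → 0 < s → s ≤ # tips? → Candidate s
  candidate s 0<t 0<s enough = assemble s 0<t 0<s (count-selection (λ F → ⌊ tips? F ⌋) s enough)
    (count-selection (λ F → ⌊ crowns? F ⌋) (t ⊓ s) (≤-trans (m⊓n≤m t s) (≤-reflexive (sym #-crowns))))

  module Endgame (s : ℕ) {P : Subset n → Set} (P? : Decidable P)
    (uniform : ∀ F → P F → ∣ F ∣ ≡ k)
    (almost : ∀ F → P F → # (far P? t F) ≤ s)
    (crossing : ¬ (∀ F F′ → P F → P F′ → t ≤ ∣ F ∩ F′ ∣))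
    (contained : ∀ F → P F → R ⊈ F → F ⊆ W)
    (outsider : ∃ λ G → P G × R ⊈ G)
    (large : # stars? + (s + t ⊓ s) ≤ # P?) where

    pStars? : Decidable (λ F → P F × Stars F)
    pStars? F = P? F ×-dec stars? F

    pTips? : Decidable (λ F → P F × Tips F)
    pTips? F = P? F ×-dec tips? F

    pCrowns? : Decidable (λ F → P F × R ⊈ F)
    pCrowns? F = P? F ×-dec ¬? (R ⊆? F)

    -- The outsider is a crown, so all tips in the family are far from it.
    tips-few : # pTips? ≤ s
    tips-few = let G , pG , R⊈G = outsider in
      ≤-trans (#-mono pTips? (far P? t G) λ F (p , tip) → p , tip-crown F G tip (contained G pG R⊈G) R⊈G) (almost G pG)

    -- Without tips only stars and crowns remain, and these pairwise meet in t points.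
    some-tip : ∃ λ A → P A × Tips A
    some-tip with anySubset? pTips?
    ... | yes found = found
    ... | no  none  = ⊥-elim (crossing λ F F′ p p′ → meet F F′ p p′ (R ⊆? F) (R ⊆? F′))
      where
      wide : ∀ F → P F → R ⊆ F → suc t ≤ ∣ F ∩ W ∣
      wide F p R⊆F = [ (λ star → proj₂ (proj₂ star)) , (λ tip → ⊥-elim (none (F , p , tip))) ]′
        (star-or-tip F (uniform F p) R⊆F)
      meet : ∀ F F′ → P F → P F′ → Dec (R ⊆ F) → Dec (R ⊆ F′) → t ≤ ∣ F ∩ F′ ∣
      meet F F′ p p′ (yes f) (yes f′) = over-meet F F′ f f′
      meet F F′ p p′ (yes f) (no ¬f′) = star-crown F F′ (wide F p f) (uniform _ p′) (contained _ p′ ¬f′)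
      meet F F′ p p′ (no ¬f) (yes f′) = crown-star F F′ (uniform F p) (contained _ p ¬f) (wide F′ p′ f′)
      meet F F′ p p′ (no ¬f) (no ¬f′) = star-crown F F′ (crown-large F (uniform F p) (contained _ p ¬f))
        (uniform _ p′) (contained _ p′ ¬f′)

    -- There are only t crowns in all, and every crown in the family is far from one fixed tip; the
    -- two reasons produce the minimum.
    crowns-few : # pCrowns? ≤ t ⊓ s
    crowns-few = ⊓-glb
      (≤-trans (#-mono pCrowns? crowns? λ F (p , R⊈F) → uniform F p , contained F p R⊈F , R⊈F) (≤-reflexive #-crowns))
      (let A , pA , tip = some-tip in
       ≤-trans (#-mono pCrowns? (far P? t A) λ F (p , R⊈F) → p , crown-tip A F tip (contained F p R⊈F) R⊈F) (almost A pA))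

    stars-few : # pStars? ≤ # stars?
    stars-few = #-mono pStars? stars? λ _ → proj₂

    parts : # P? ≤ # pStars? + (# pTips? + # pCrowns?)
    parts = ≤-trans (#-case P? (R ⊆?_)) (≤-trans
      (+-monoˡ-≤ (# pCrowns?) (#-split (over P? R) pStars? pTips? λ F (p , R⊆F) → sort F p (star-or-tip F (uniform F p) R⊆F)))
      (≤-reflexive (+-assoc (# pStars?) (# pTips?) (# pCrowns?))))
      where
      sort : ∀ F → P F → Stars F ⊎ Tips F → (P F × Stars F) ⊎ (P F × Tips F)
      sort F p = [ (λ x → inj₁ (p , x)) , (λ x → inj₂ (p , x)) ]′

    total : # stars? + (s + t ⊓ s) ≤ # pStars? + (# pTips? + # pCrowns?)
    total = ≤-trans large parts

    squeeze : ∀ {a b c a′ b′ c′} → a ≤ a′ → b ≤ b′ → c ≤ c′ → a′ + (b′ + c′) ≤ a + (b + c) →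
              a′ ≤ a × b ≡ b′ × c ≡ c′
    squeeze {a} {b} {c} {a′} {b′} {c′} a≤ b≤ c≤ le =
      +-cancelʳ-≤ (b + c) a′ a (≤-trans (+-monoʳ-≤ a′ (+-mono-≤ b≤ c≤)) le) ,
      ≤-antisym b≤ (+-cancelʳ-≤ c b′ b (≤-trans (+-monoʳ-≤ b′ c≤) rest)) ,
      ≤-antisym c≤ (+-cancelˡ-≤ b c′ c (≤-trans (+-monoˡ-≤ c′ b≤) rest))
      where
      rest : b′ + c′ ≤ b + c
      rest = +-cancelˡ-≤ a _ _ (≤-trans (+-monoˡ-≤ (b′ + c′) a≤) le)

    -- The three upper bounds sum to the lower bound `large`, so none of them can be strict.
    exact : # stars? ≤ # pStars? × # pTips? ≡ s × # pCrowns? ≡ t ⊓ s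
    exact = squeeze stars-few tips-few crowns-few total

    all-stars : ∀ F → Stars F → P F
    all-stars F star = proj₁ (#-full pStars? stars? (λ _ → proj₂) (proj₁ exact) F star)

-- Carrying the pattern to initial segments

Conclusion : (n k t s : ℕ) → Family n → Set
Conclusion n k t s 𝓕 = Σ (Family n) λ 𝓐 → Σ (Family n) λ 𝓑 →
  ((∀ F → T (𝓐 F) → ∣ F ∣ ≡ k × F ∩ [ suc k ]ₛ ≡ [ t ]ₛ) × size 𝓐 ≡ s) ×
  ((∀ F → T (𝓑 F) → F ⊆ [ suc k ]ₛ × ∣ F ∣ ≡ k × ¬ ([ t ]ₛ ⊆ F)) × size 𝓑 ≡ t ⊓ s) ×
  (𝓕 ≅ ((HFam k t ∪ᶠ 𝓐) ∪ᶠ 𝓑))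

Extremal : (n k t s : ℕ) → Set
Extremal n k t s = (𝓕 : Family n) → Uniform k 𝓕 → AlmostIntersecting s t 𝓕 → ¬ Intersecting t 𝓕 →
  ((𝓖 : Family n) → Uniform k 𝓖 → AlmostIntersecting s t 𝓖 → ¬ Intersecting t 𝓖 → size 𝓖 ≤ size 𝓕) →
  Conclusion n k t s 𝓕

module _ {n : ℕ} (σ : Permutation′ n) where

  #-image : ∀ {P Q : Subset n → Set} (P? : Decidable P) (Q? : Decidable Q) →
            (∀ F → P F → Q (image σ F)) → (∀ F → Q F → P (image (flip σ) F)) → # P? ≡ # Q?
  #-image P? Q? f g = ≤-antisym
    (#-injection P? Q? (image σ) f (image-injective σ))
    (#-injection Q? P? (image (flip σ)) g (image-injective (flip σ)))

module _ {n t e s : ℕ} (𝓕 : Family n) (R W : Subset n) (R⊆W : R ⊆ W) (R≡ : ∣ R ∣ ≡ t)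
         (W≡ : ∣ W ∣ ≡ suc (t + (2 + e))) where

  open Pattern {n} {t} {e} R W R⊆W R≡ W≡ using (k; Stars; Tips; stars?; tips?; star-or-tip)

  -- The families 𝓐 and 𝓑 are the images of the tips and crowns that occur in `𝓕`, described by
  -- membership of the preimage `τ F`; their sizes survive because `image σ` and `τ` are mutually
  -- inverse.
  transport : (∀ F → T (𝓕 F) → ∣ F ∣ ≡ k) →
    (∀ F → T (𝓕 F) → R ⊈ F → F ⊆ W) →
    (∀ F → Stars F → T (𝓕 F)) →
    # (λ F → T? (𝓕 F) ×-dec tips? F) ≡ s →
    # (λ F → T? (𝓕 F) ×-dec ¬? (R ⊆? F)) ≡ t ⊓ s →
    Conclusion n k t s 𝓕
  transport uniform contained all-stars #A #B = build (straighten R W R⊆W)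
    where
    build : (∃ λ (σ : Permutation′ n) → image σ R ≡ [ ∣ R ∣ ]ₛ × image σ W ≡ [ ∣ W ∣ ]ₛ) → Conclusion n k t s 𝓕
    build (σ , imR , imW) = (λ F → ⌊ A? F ⌋) , (λ F → ⌊ B? F ⌋) , (A-spec , A-size) , (B-spec , B-size) , σ , iso
      where
      τ : Subset n → Subset n
      τ = image (flip σ)
      σR : image σ R ≡ [ t ]ₛ
      σR = trans imR (cong (λ m → [ m ]ₛ) R≡)
      σW : image σ W ≡ [ suc k ]ₛ
      σW = trans imW (cong (λ m → [ m ]ₛ) W≡)
      A : Subset n → Set
      A F = T (𝓕 (τ F)) × Tips (τ F)
      A? : Decidable A
      A? F = T? (𝓕 (τ F)) ×-dec tips? (τ F)
      B : Subset n → Set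
      B F = T (𝓕 (τ F)) × R ⊈ τ F
      B? : Decidable B
      B? F = T? (𝓕 (τ F)) ×-dec ¬? (R ⊆? τ F)
      back : ∀ F → image σ (τ F) ≡ F
      back = flip-image σ
      card : ∀ F → ∣ τ F ∣ ≡ ∣ F ∣
      card = ∣image∣ (flip σ)
      cut : ∀ F → image σ (F ∩ W) ≡ image σ F ∩ [ suc k ]ₛ
      cut F = trans (image-∩ σ F W) (cong (image σ F ∩_) σW)
      A-spec : ∀ F → T ⌊ A? F ⌋ → ∣ F ∣ ≡ k × F ∩ [ suc k ]ₛ ≡ [ t ]ₛ
      A-spec F a = let _ , F≡ , eq = toWitness {a? = A? F} a in
        trans (sym (card F)) F≡ ,
        trans (cong (_∩ [ suc k ]ₛ) (sym (back F))) (trans (sym (cut (τ F))) (trans (cong (image σ) eq) σR))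
      B-spec : ∀ F → T ⌊ B? F ⌋ → F ⊆ [ suc k ]ₛ × ∣ F ∣ ≡ k × ¬ ([ t ]ₛ ⊆ F)
      B-spec F b = let p , R⊈ = toWitness {a? = B? F} b in
        subst₂ _⊆_ (back F) σW (image-⊆ σ (contained (τ F) p R⊈)) ,
        trans (sym (card F)) (uniform (τ F) p) ,
        λ le → R⊈ (image-⊆⁻ σ (subst₂ _⊆_ (sym σR) (sym (back F)) le))
      A-size : size (λ F → ⌊ A? F ⌋) ≡ s
      A-size = trans (sym (#-image σ (λ F → T? (𝓕 F) ×-dec tips? F) A?
        (λ F a → subst (λ G → T (𝓕 G) × Tips G) (sym (image-flip σ F)) a) (λ F a → a))) #A
      B-size : size (λ F → ⌊ B? F ⌋) ≡ t ⊓ s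
      B-size = trans (sym (#-image σ (λ F → T? (𝓕 F) ×-dec ¬? (R ⊆? F)) B?
        (λ F b → subst (λ G → T (𝓕 G) × R ⊈ G) (sym (image-flip σ F)) b) (λ F b → b))) #B
      star⁺ : ∀ F → Stars F → T (HFam k t (image σ F))
      star⁺ F (F≡ , R⊆F , le) = T-∧⁺ (≡⇒≡ᵇ _ _ (trans (∣image∣ σ F) F≡))
        (T-∧⁺ (fromWitness {a? = [ t ]ₛ ⊆? image σ F} (subst (_⊆ image σ F) σR (image-⊆ σ R⊆F)))
          (≤⇒≤ᵇ (≤-trans le (≤-reflexive (trans (sym (∣image∣ σ (F ∩ W))) (cong ∣_∣ (cut F)))))))
      star⁻ : ∀ F → T (HFam k t (image σ F)) → Stars F
      star⁻ F h =
        let h₁ , h₂₃ = T-∧⁻ (∣ image σ F ∣ ≡ᵇ k) h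
            h₂ , h₃  = T-∧⁻ ⌊ [ t ]ₛ ⊆? image σ F ⌋ h₂₃
        in trans (sym (∣image∣ σ F)) (≡ᵇ⇒≡ _ _ h₁) ,
           image-⊆⁻ σ (subst (_⊆ image σ F) (sym σR) (toWitness {a? = [ t ]ₛ ⊆? image σ F} h₂)) ,
           ≤-trans (≤ᵇ⇒≤ _ _ h₃) (≤-reflexive (sym (trans (sym (∣image∣ σ (F ∩ W))) (cong ∣_∣ (cut F)))))
      G : Subset n → Bool
      G F = ((HFam k t ∪ᶠ (λ F → ⌊ A? F ⌋)) ∪ᶠ (λ F → ⌊ B? F ⌋)) F
      there′ : ∀ F → T (𝓕 F) → T (G (image σ F))
      there′ F p = sort (R ⊆? F)
        where
        H = HFam k t (image σ F)
        a = ⌊ A? (image σ F) ⌋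
        p′ : T (𝓕 (τ (image σ F)))
        p′ = subst (T ∘ 𝓕) (sym (image-flip σ F)) p
        sort : Dec (R ⊆ F) → T (G (image σ F))
        sort (no R⊈F) = T-∨⁺ (H ∨ a) (inj₂ (fromWitness {a? = B? (image σ F)}
          (p′ , subst (R ⊈_) (sym (image-flip σ F)) R⊈F)))
        sort (yes R⊆F) = T-∨⁺ (H ∨ a) (inj₁ (T-∨⁺ H ([ inj₁ ∘ star⁺ F ,
          (λ tip → inj₂ (fromWitness {a? = A? (image σ F)} (p′ , subst Tips (sym (image-flip σ F)) tip))) ]′
          (star-or-tip F (uniform F p) R⊆F))))
      here′ : ∀ F → T (G (image σ F)) → T (𝓕 F)
      here′ F g = [ (λ g′ → [ all-stars F ∘ star⁻ F , (λ a → home (proj₁ (toWitness {a? = A? (image σ F)} a))) ]′ (T-∨⁻ H g′)) ,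
          (λ b → home (proj₁ (toWitness {a? = B? (image σ F)} b))) ]′ (T-∨⁻ (H ∨ a) g)
        where
        H = HFam k t (image σ F)
        a = ⌊ A? (image σ F) ⌋
        home : T (𝓕 (τ (image σ F))) → T (𝓕 F)
        home = subst (T ∘ 𝓕) (image-flip σ F)
      iso : ∀ F → 𝓕 F ≡ G (image σ F)
      iso F = T-ext (there′ F) (here′ F)

-- Comparison with the extremal size

module Main (u e s m : ℕ) where

  t n k : ℕ
  t = suc u
  n = suc t + suc m
  k = t + (2 + e)

  module _
    (0<s : 0 < s)
    (dense : 4 * ((t + 1) * (t + 2)) * ((3 + e) * (3 + e) + s) ≤ 3 * suc m)
    (wide : 4 * (2 + e) * ((3 + e) * (3 + e) + s) ≤ 3 * suc m)
    (room : 2 + e + (t + 3) * ((3 + e) * (3 + e) + s) ≤ suc m)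
    (𝓕 : Family n) (uniform : Uniform k 𝓕) (almost′ : AlmostIntersecting s t 𝓕)
    (crossing : ¬ Intersecting t 𝓕)
    (maximal : (𝓖 : Family n) → Uniform k 𝓖 → AlmostIntersecting s t 𝓖 → ¬ Intersecting t 𝓖 → size 𝓖 ≤ size 𝓕)
    where

    open Numbers t e s m room wide using (N₁; N₂; N-shift; N₁-shift; ratio; m≤N₁; bound-≤; bound-zero; s≤tips; stars-large)

    P : Subset n → Set
    P F = T (𝓕 F)

    P? : Decidable P
    P? F = T? (𝓕 F)

    suc-k≤n : suc k ≤ n
    suc-k≤n = s≤s (+-monoʳ-≤ t (≤-trans (m≤m+n (2 + e) _) room))

    module AtPattern (R W : Subset n) (R⊆W : R ⊆ W) (R≡ : ∣ R ∣ ≡ t) (W≡ : ∣ W ∣ ≡ suc k) where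

      module Pat = Pattern {n} {t} {e} R W R⊆W R≡ W≡

      lower : # Pat.stars? + (s + t ⊓ s) ≤ # P?
      lower = let 𝓖 , uni , alm , cro , le = Pat.candidate s (s≤s z≤n) 0<s (≤-trans s≤tips (≤-reflexive (sym Pat.#-tips)))
        in ≤-trans le (≤-trans (maximal 𝓖 uni alm cro) (≤-reflexive (size-# 𝓕)))

      -- One crown is enough for the numerical contradictions; the full minimum is kept in `lower`
      -- for the equality analysis.
      lower-strict : # Pat.stars? + s + 1 ≤ # P?
      lower-strict = ≤-trans (≤-reflexive (+-assoc (# Pat.stars?) s 1))
        (≤-trans (+-monoʳ-≤ (# Pat.stars?) (+-monoʳ-≤ s (⊓-glb (s≤s z≤n) 0<s))) lower)

    almost : ∀ F → P F → # (far P? t F) ≤ s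
    almost F p = ≤-trans (≤-reflexive (sym (far-count t 𝓕 F))) (almost′ F p)

    open Structure {n} {t} {e} {s} P? (≤-trans (n≤1+n k) suc-k≤n) uniform almost crossing

    light≡ : light ≡ s + (3 + e) * N₂
    light≡ = cong (λ x → s + (3 + e) * x) (N-shift 0)

    dense-light : 4 * ((t + 1) * (t + 2)) * light ≤ 3 * N₁
    dense-light = subst (λ x → 4 * ((t + 1) * (t + 2)) * x ≤ 3 * N₁) (sym light≡)
      (scale-light t e s m N₁ N₂ ratio m≤N₁ dense)

    thin : 4 * (t + 1) * light ≤ N₁
    thin = thin-light u N₁ light dense-light

    frame-exists : ∃ λ R → ∃ λ W → R ⊆ W × ∣ R ∣ ≡ t × ∣ W ∣ ≡ suc k
    frame-exists =
      let W , _ , W≡ = sub-of-size (⊤ {n}) (suc k) (≤-trans suc-k≤n (≤-reflexive (sym (∣⊤∣≡n n))))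
          R , R⊆W , R≡ = sub-of-size W t (≤-trans (≤-trans (m≤m+n t (2 + e)) (n≤1+n k)) (≤-reflexive (sym W≡)))
      in R , W , R⊆W , R≡ , W≡

    -- Maximality applies to the pattern on any frame, so the size of `𝓕` is bounded below before
    -- anything is known about its structure.
    reference : ∃ λ h → (5 + 2 * e) * N₁ ≤ 2 * h × h + s + 1 ≤ # P?
    reference = let R , W , R⊆W , R≡ , W≡ = frame-exists
                    open AtPattern R W R⊆W R≡ W≡
      in # Pat.stars? , stars-large (# Pat.stars?) Pat.#-stars , lower-strict

    concentrated : Concentrated
    concentrated with anySubset? (λ L → anySubset? (λ L′ → heavy? L ×-dec heavy? L′ ×-dec ¬? (L ≟ₛ L′)))
    ... | yes (L , L′ , heavy , heavy′ , L≢L′) = decide (Sunflower.sunflower L L′ heavy heavy′ L≢L′)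
      where
      decide : Concentrated ⊎ # P? ≤ s + (light + (2 + e) * N (1 + t)) + t * light → Concentrated
      decide (inj₁ c)    = c
      decide (inj₂ small) = let h , big , low = reference in
        ⊥-elim (too-small-sunflower t e s N₁ light h (# P?) thin big low
          (subst (λ x → # P? ≤ s + (light + (2 + e) * x) + t * light) N₁-shift small))
    -- `escape` at the full set serves only to produce a member, the almost cover of size k at which
    -- the descent starts.
    ... | no distinct = ⊥-elim (descend (escape ⊤ (≤-trans (≤-trans (m≤m+n t (2 + e)) (≤-trans (n≤1+n k) suc-k≤n)) (≤-reflexive (sym (∣⊤∣≡n n))))))
      where
      unique : ∀ L L′ → Heavy L → Heavy L′ → L ≡ L′
      unique L L′ heavy heavy′ with L ≟ₛ L′
      ... | yes eq = eq
      ... | no  ne = ⊥-elim (distinct (L , L′ , heavy , heavy′ , ne))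
      k≡ : k ≡ 1 + (1 + e + t)
      k≡ = +-comm t (2 + e)
      finish : (∃ λ K → ∣ K ∣ ≡ 1 + t × AlmostCover K) ⊎ (∃ λ i → 2 + (i + t) ≤ k × # P? ≤ s + coverBound i) → _
      finish (inj₁ (K , K≡ , cover)) = let h , big , low = reference in
        too-small-kernel t e s N₁ light h (# P?) thin (m≤m+n s _) big low
          (subst (λ x → # P? ≤ x + (s + (t + 1) * (s + (3 + e) * light))) N₁-shift (unique-heavy unique K K≡ cover))
      finish (inj₂ (i , i≤ , small)) = let h , big , low = reference in
        too-small-cover t e s N₁ light h (# P?) (binom (2 + t) 2) (binom-two t) dense-light big low
          (≤-trans small (+-monoʳ-≤ s (≤-trans (bound-≤ i i≤e) (≤-reflexive bound-zero))))
        where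
        i≤e : i ≤ e
        i≤e = +-cancelʳ-≤ t i e (s≤s⁻¹ (s≤s⁻¹ (≤-trans i≤ (≤-reflexive k≡))))
      descend : (∃ λ G → P G × ⊤ ⊈ G) → _
      descend (G , pG , _) = finish (cover-descent (1 + e) (≤-reflexive (sym k≡)) (G , trans (uniform G pG) k≡ , almost G pG))

    extremal : Conclusion n k t s 𝓕
    extremal = let R , W , R⊆W , R≡ , W≡ , contained , outsider = concentrated
                   open AtPattern R W R⊆W R≡ W≡
                   module End = Pat.Endgame s P? uniform almost crossing contained outsider lower
      in transport {n} {t} {e} {s} 𝓕 R W R⊆W R≡ W≡ uniform contained End.all-stars
           (proj₁ (proj₂ End.exact)) (proj₂ (proj₂ End.exact))

theorem1p4 : (n k t s : ℕ) → 0 < n → 0 < k → 0 < t → 0 < s →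
    t + 2 ≤ k →
    3 * ((2 * ((t + 2) C 2)) ⊔ (k ∸ t)) * ((k ∸ t + 1) ^ 2 + s) ≤ 2 * n →
    (𝓕 : Family n) →
    Uniform k 𝓕 → AlmostIntersecting s t 𝓕 → ¬ Intersecting t 𝓕 →
    ((𝓖 : Family n) → Uniform k 𝓖 → AlmostIntersecting s t 𝓖 → ¬ Intersecting t 𝓖 →
    size 𝓖 ≤ size 𝓕) →
    Σ (Family n) λ 𝓐 → Σ (Family n) λ 𝓑 →
    ((∀ F → T (𝓐 F) → ∣ F ∣ ≡ k × F ∩ [ suc k ]ₛ ≡ [ t ]ₛ) × size 𝓐 ≡ s) ×
    ((∀ F → T (𝓑 F) → F ⊆ [ suc k ]ₛ × ∣ F ∣ ≡ k × ¬ ([ t ]ₛ ⊆ F)) × size 𝓑 ≡ t ⊓ s) ×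
    (𝓕 ≅ ((HFam k t ∪ᶠ 𝓐) ∪ᶠ 𝓑))
theorem1p4 n k (suc u) s _ _ _ 0<s t+2≤k ground with m≤n⇒∃[o]m+o≡n t+2≤k
... | e , eq = prepare n k (trans (sym eq) (+-assoc (suc u) 2 e)) ground
  where
  prepare : ∀ n k → k ≡ suc u + (2 + e) →
    3 * ((2 * ((suc u + 2) C 2)) ⊔ (k ∸ suc u)) * ((k ∸ suc u + 1) ^ 2 + s) ≤ 2 * n →
    Extremal n k (suc u) s
  prepare n _ refl ground = settle n
    (ground-size n u e s M pairs≤M (≤-trans (≤-reflexive (sym gap)) (m≤n⊔m _ _))
      (subst (λ x → 3 * M * (x + s) ≤ 2 * n) square ground))
    where
    -- Twice the maximum in the theorem, so that (k - t) / 2 stays a natural number.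
    M = (2 * ((suc u + 2) C 2)) ⊔ (suc u + (2 + e) ∸ suc u)
    gap : suc u + (2 + e) ∸ suc u ≡ 2 + e
    gap = m+n∸m≡n (suc u) (2 + e)
    square : (suc u + (2 + e) ∸ suc u + 1) ^ 2 ≡ (3 + e) * (3 + e)
    square = trans (cong (_^ 2) (trans (cong (_+ 1) gap) (+-comm (2 + e) 1))) (cong ((3 + e) *_) (*-identityʳ (3 + e)))
    pairs : 2 * ((suc u + 2) C 2) ≡ (suc u + 2) * (suc u + 1)
    pairs = trans (cong (2 *_) (trans (sym (binom≡C (suc u + 2) 2)) (cong (λ x → binom x 2) (+-comm (suc u) 2))))
      (trans (binom-two (suc u)) (*-comm (suc u + 1) (suc u + 2)))
    pairs≤M : (suc u + 2) * (suc u + 1) ≤ M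
    pairs≤M = ≤-trans (≤-reflexive (sym pairs)) (m≤m⊔n _ _)
    settle : ∀ n → (∃ λ m → n ≡ suc (suc u) + suc m × _ × _ × _) → Extremal n (suc u + (2 + e)) (suc u) s
    settle _ (m , refl , dense , wide , room) = Main.extremal u e s m 0<s dense wide room
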